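{- Given a connected graph $G$ with $n$ vertices that admits an independent cutset, a minimum independent cutset of $G$ (that is, one of minimum cardinality) can be found in $\mathcal{O}^*(3^{n/3})$ time.
   Context: All graphs are finite, simple, loopless and undirected. A set $S$ of vertices of a graph $G$ is a cutset of $G$ if $G-S$ is disconnected; it is an independent set if its vertices are pairwise nonadjacent. An independent cutset of $G$ is a set of vertices that is both a cutset and an independent set of $G$. The notation $\mathcal{O}^*$ is the $\mathcal{O}$-notation with factors polynomial in the input size suppressed. -}

module Defs where

open import Data.Bool.Base using (Bool; true; false)
open import Data.Fin.Base using (Fin)
open import Data.Fin.Subset using (Subset; _∈_; ∁; ⊤; ∣_∣)
open import Data.Nat.Base using (ℕ; suc; _+_; _*_; _^_; _≤_; NonZero)
open import Data.Product.Base using (_×_; ∃-syntax)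
open import Data.Vec.Base using (Vec; []; _∷_; lookup; map; foldr′; tabulate)
open import Relation.Binary.Construct.Closure.ReflexiveTransitive using (Star)
open import Relation.Binary.PropositionalEquality.Core using (_≡_)
open import Relation.Nullary.Negation.Core using (¬_)

------------------------------------------------------------------------
-- Graphs

record Graph (n : ℕ) : Set where
  field
    adj       : Fin n → Fin n → Bool
    symmetric : ∀ u v → adj u v ≡ adj v u
    loopless  : ∀ v → adj v v ≡ false

  Adjacent : Fin n → Fin n → Set
  Adjacent u v = adj u v ≡ true

open Graph public

module _ {n : ℕ} (G : Graph n) where

  -- Adjacency in the subgraph G[W] induced by W; G − S is G[∁ S].
  InducedAdjacent : Subset n → Fin n → Fin n → Set
  InducedAdjacent W u v = u ∈ W × v ∈ W × Adjacent G u v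

  -- Any two vertices of G[W] are joined by a walk in G[W].  The graph with no
  -- vertices counts as connected, so the whole vertex set is never a cutset.
  InducedConnected : Subset n → Set
  InducedConnected W = ∀ u v → u ∈ W → v ∈ W → Star (InducedAdjacent W) u v

  Connected : Set
  Connected = InducedConnected ⊤

  Cutset : Subset n → Set
  Cutset S = ¬ InducedConnected (∁ S)

  Independent : Subset n → Set
  Independent S = ∀ u v → u ∈ S → v ∈ S → ¬ Adjacent G u v

  IndependentCutset : Subset n → Set
  IndependentCutset S = Cutset S × Independent S

  MinimumIndependentCutset : Subset n → Set
  MinimumIndependentCutset S =
    IndependentCutset S × (∀ S′ → IndependentCutset S′ → ∣ S ∣ ≤ ∣ S′ ∣)

------------------------------------------------------------------------
-- Model of computation
--
-- Deterministic first-order recursive programs over binary trees (pure LISP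
-- with a single atom), evaluated call-by-value.  Every evaluation rule costs
-- one unit.  With values held as pointers to shared cells, each rule takes a
-- number of pointer operations depending only on the program, so t units are
-- simulated by a RAM in O(t) operations on O(log t)-bit words; conversely, RAM
-- memory can be kept in a balanced tree with overhead polynomial in the length
-- of the addresses and words.  When addresses and words have polynomially many
-- bits, the two models thus give the same running times up to polynomial
-- factors, hence the same O* bounds.

infixr 5 _∙_

data Tree : Set where
  nil : Tree
  _∙_ : Tree → Tree → Tree

-- Expr ar k: expressions with k free variables (de Bruijn indices), over
-- function symbols with arities ar.
data Expr {m : ℕ} (ar : Vec ℕ m) (k : ℕ) : Set where
  var   : Fin k → Expr ar k
  nil   : Expr ar k
  cons  : Expr ar k → Expr ar k → Expr ar k
  -- match e e₁ e₂ is e₁ if e is nil; otherwise it is e₂ with index 0 bound to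
  -- the left subtree of e and index 1 to the right one.
  match : Expr ar k → Expr ar k → Expr ar (2 + k) → Expr ar k
  bind  : Expr ar k → Expr ar (suc k) → Expr ar k
  call  : (f : Fin m) → Vec (Expr ar k) (lookup ar f) → Expr ar k

record Program : Set where
  field
    {size}  : ℕ
    arities : Vec ℕ size
    body    : (f : Fin size) → Expr arities (lookup arities f)
    main    : Expr arities 1

module Evaluation {m : ℕ} {ar : Vec ℕ m}
                  (body : (f : Fin m) → Expr ar (lookup ar f)) where

  infix 4 _⊢_⇓_[_] _⊢_⇓*_[_]

  mutual
    -- ρ ⊢ e ⇓ v [ t ]: in environment ρ, e evaluates to v at cost t.
    data _⊢_⇓_[_] {k : ℕ} (ρ : Vec Tree k) : Expr ar k → Tree → ℕ → Set where
      var : ∀ i → ρ ⊢ var i ⇓ lookup ρ i [ 1 ]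
      nil : ρ ⊢ nil ⇓ nil [ 1 ]
      cons : ∀ {e₁ e₂ v₁ v₂ t₁ t₂} →
        ρ ⊢ e₁ ⇓ v₁ [ t₁ ] → ρ ⊢ e₂ ⇓ v₂ [ t₂ ] →
        ρ ⊢ cons e₁ e₂ ⇓ v₁ ∙ v₂ [ 1 + t₁ + t₂ ]
      match-nil : ∀ {e e₁ e₂ v t t₁} →
        ρ ⊢ e ⇓ nil [ t ] → ρ ⊢ e₁ ⇓ v [ t₁ ] →
        ρ ⊢ match e e₁ e₂ ⇓ v [ 1 + t + t₁ ]
      match-∙ : ∀ {e e₁ e₂ l r v t t₂} →
        ρ ⊢ e ⇓ l ∙ r [ t ] → l ∷ r ∷ ρ ⊢ e₂ ⇓ v [ t₂ ] →
        ρ ⊢ match e e₁ e₂ ⇓ v [ 1 + t + t₂ ]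
      bind : ∀ {e e₁ v v₁ t t₁} →
        ρ ⊢ e ⇓ v [ t ] → v ∷ ρ ⊢ e₁ ⇓ v₁ [ t₁ ] →
        ρ ⊢ bind e e₁ ⇓ v₁ [ 1 + t + t₁ ]
      call : ∀ {f es vs v t t′} →
        ρ ⊢ es ⇓* vs [ t ] → vs ⊢ body f ⇓ v [ t′ ] →
        ρ ⊢ call f es ⇓ v [ 1 + t + t′ ]

    data _⊢_⇓*_[_] {k : ℕ} (ρ : Vec Tree k) :
                   ∀ {j} → Vec (Expr ar k) j → Vec Tree j → ℕ → Set where
      []  : ρ ⊢ [] ⇓* [] [ 0 ]
      _∷_ : ∀ {j e v t t′} {es : Vec (Expr ar k) j} {vs : Vec Tree j} →
        ρ ⊢ e ⇓ v [ t ] → ρ ⊢ es ⇓* vs [ t′ ] →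
        ρ ⊢ e ∷ es ⇓* v ∷ vs [ t + t′ ]

_on_outputs_within_ : Program → Tree → Tree → ℕ → Set
P on x outputs y within b = ∃[ t ] (x ∷ [] ⊢ main ⇓ y [ t ] × t ≤ b)
  where
  open Program P
  open Evaluation body

------------------------------------------------------------------------
-- Input and output format

encodeBit : Bool → Tree
encodeBit false = nil
encodeBit true  = nil ∙ nil

encodeList : ∀ {n} → Vec Tree n → Tree
encodeList = foldr′ _∙_ nil

encodeBits : ∀ {n} → Vec Bool n → Tree
encodeBits bs = encodeList (map encodeBit bs)

-- The adjacency matrix, as a list of rows.
encodeGraph : ∀ {n} → Graph n → Tree
encodeGraph G =
  encodeList (tabulate λ u → encodeBits (tabulate λ v → adj G u v))

-- The characteristic vector.
encodeSubset : ∀ {n} → Subset n → Tree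
encodeSubset = encodeBits

------------------------------------------------------------------------
-- O* bounds

-- T(n) = O*(b^(n/d)): eventually T(n) ≤ c · n^k · b^(n/d) for some c and k,
-- with both sides raised to the d-th power to stay within ℕ.  The encoding of
-- a graph with n vertices has size Θ(n²), so polynomial in the input size
-- means polynomial in n.
_∈O*[_^n/_] : (ℕ → ℕ) → ℕ → (d : ℕ) → .{{NonZero d}} → Set
T ∈O*[ b ^n/ d ] =
  ∃[ c ] ∃[ k ] ∃[ n₀ ] (∀ n → n₀ ≤ n → T n ^ d ≤ (c * n ^ k) ^ d * b ^ n)

{-# OPTIONS --safe #-}
module Submission where

-- Branch on a maximal independent set.  If v has minimum degree in the graph
-- G[R] of the undecided vertices, then every independent set J either meets
-- N[v] or stays independent when v is added, so it suffices to branch over the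
-- s = |N[v] ∩ R| vertices u of N[v] ∩ R, each time passing to R ∖ N[u], which
-- has lost at least s vertices.  As s ^ 3 ≤ 3 ^ s, there are at most
-- 3 ^ (n / 3) leaves, and every independent set lies in the set I of a leaf.
--
-- At a leaf, a minimum cutset inside I is a minimum cut of the hypergraph with
-- vertices V ∖ I and hyperedges N[x] ∖ I, where cutting the hyperedge of some x
-- outside I is forbidden.  It is found as in the algorithm of Stoer and Wagner:
-- in a maximum adjacency ordering that ends in t, u, the cut that isolates u is
-- minimum among those that separate t from u; then u is contracted into t.
--
-- The program is written in a typed language of bounded loops over Fin n, in
-- which the cost of every term is bounded by a polynomial in n that is read off
-- its syntax.

open import Defs
open import Data.Bool.Base using (Bool; true; false; if_then_else_; T)
import Data.Bool.Properties as Bool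
open import Data.Empty using (⊥; ⊥-elim)
open import Data.Fin.Base using (Fin; zero; suc; toℕ; fromℕ; inject₁; splitAt; join)
open import Data.Fin.Properties using (toℕ-inject₁; toℕ-fromℕ; splitAt-join; _≟_)
open import Data.Fin.Relation.Unary.Top using (view; ‵fromℕ; ‵inject₁)
open import Data.Fin.Subset using (_∈_; ∁; ∣_∣)
open import Data.Fin.Subset.Properties using (∈⊤; x∈∁p⇒x∉p; x∉p⇒x∈∁p)
open import Data.List.Base using (List; []; _∷_)
open import Data.Nat.Base
  using (ℕ; zero; suc; _+_; _*_; _^_; _∸_; _≤_; _<_; z≤n; s≤s; s≤s⁻¹; _≤ᵇ_)
open import Data.Nat.Properties
  using (≤-refl; ≤-trans; ≤-reflexive; ≤-total; <⇒≱; ≰⇒≥; n≤0⇒n≡0; n≤1+n; m≤n⇒m≤1+n; _≤?_;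
         m≤n⇒m<n∨m≡n; ≤ᵇ⇒≤; ≤⇒≤ᵇ; +-assoc; +-suc; +-identityʳ; *-identityʳ; *-distribʳ-+;
         +-mono-≤; +-monoˡ-≤; +-monoʳ-≤; *-mono-≤; *-monoˡ-≤; *-monoʳ-≤; ^-monoˡ-≤; ^-monoʳ-≤;
         ^-distribˡ-+-*; m≤m+n; m≤n+m; m≤m*n; m+n≤o⇒m≤o∸n; m∸n≤m; ∸-monoˡ-≤; m+[n∸m]≡n;
         module ≤-Reasoning)
open import Data.Nat.Tactic.RingSolver using (solve-∀)
open import Data.Product.Base using (_×_; _,_; proj₁; proj₂; ∃-syntax)
open import Data.Sum.Base using (_⊎_; inj₁; inj₂; [_,_]′)
open import Data.Unit.Base using (⊤; tt)
open import Data.Vec.Base using (Vec; []; _∷_; lookup; replicate; tabulate; foldr′)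
open import Data.Vec.Properties
  using (lookup-replicate; tabulate-∘; tabulate-cong; lookup∘tabulate; tabulate∘lookup;
         []=⇒lookup; lookup⇒[]=)
open import Function.Base using (_∘_; id)
open import Relation.Binary.Construct.Closure.ReflexiveTransitive using (Star; ε; _◅_; _◅◅_)
open import Relation.Binary.PropositionalEquality
  using (_≡_; _≢_; refl; sym; trans; cong; subst; subst₂)
open import Relation.Nullary.Decidable.Core
  using (Dec; does; yes; no; ¬¬-excluded-middle; decidable-stable)
open import Relation.Nullary.Negation.Core using (¬_)

-- At a leaf no vertex outside `I` is deleted. A bipartition of those vertices forces the deletion
-- of exactly the `x` whose closed neighbourhood meets both sides, and this must never happen to an
-- `x` outside `I`: hence the hyperedges N[x] and the forbidden ones among them. Connectedness of
-- the graph enters only here: it guarantees that both sides of an independent cutset keep a vertex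
-- outside `I`.
--
-- `Cutset` is a negation, so a bipartition can be extracted from it only under double negation.
-- This suffices, because it is used to derive an inequality between cardinalities, which is
-- decidable.
--
-- The object language has neither numbers nor infinity. A weight is a set compared by cardinality,
-- and the full vertex set plays infinity; it outweighs every subset of `I` as long as some vertex
-- lies outside `I`.
--
-- A step of a branching program has two successors, so a branching over s vertices becomes a chain
-- of s binary nodes. This costs only a factor linear in n over the number of leaves.

infixl 6 _:+_
infixl 7 _:*_

-- Cost polynomials and bounded iteration

data Poly : Set where
  constant  : ℕ → Poly
  X    : Poly
  _:+_ : Poly → Poly → Poly
  _:*_ : Poly → Poly → Poly

eval : Poly → ℕ → ℕ
eval (constant c) n = c
eval X            n = n
eval (p :+ q)     n = eval p n + eval q n
eval (p :* q)     n = eval p n * eval q n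

card : ∀ {k} → (Fin k → Bool) → ℕ
card {zero}  f = 0
card {suc k} f = if f zero then suc (card (f ∘ suc)) else card (f ∘ suc)

-- The largest index comes first: a compiled loop holds a unary counter that runs down, and what
-- remains of it after a decrement is the code of the current index.
fold : ∀ {k} {A : Set} → (Fin k → A → A) → A → A
fold {zero}  f a = a
fold {suc k} f a = fold (f ∘ inject₁) (f (fromℕ k) a)

-- A language of loop programs over data of size polynomial in n

infixr 5 _⊗_

data Ty : Set where
  bool idx : Ty
  vec      : Ty → Ty
  _⊗_      : Ty → Ty → Ty

⟦_⟧ : Ty → ℕ → Set
⟦ bool ⟧  n = Bool
⟦ idx ⟧   n = Fin n
⟦ vec τ ⟧ n = Fin n → ⟦ τ ⟧ n
⟦ σ ⊗ τ ⟧ n = ⟦ σ ⟧ n × ⟦ τ ⟧ n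

Ctx : Set
Ctx = List Ty

Env : Ctx → ℕ → Set
Env []      n = ⊤
Env (τ ∷ Γ) n = ⟦ τ ⟧ n × Env Γ n

data Var : Ctx → Ty → Set where
  here  : ∀ {Γ τ} → Var (τ ∷ Γ) τ
  there : ∀ {Γ σ τ} → Var Γ τ → Var (σ ∷ Γ) τ

mutual
  -- There is no recursion, and every loop makes n rounds. Cardinalities are never values; `leᵗ`
  -- compares them through sets. In `appᵗ` the arguments are evaluated once and become the whole
  -- environment of the body, so it serves both as a call and as a local definition.
  data Term (Γ : Ctx) : Ty → Set where
    var          : ∀ {τ} → Var Γ τ → Term Γ τ
    trueᵗ falseᵗ : Term Γ bool
    condᵗ        : ∀ {τ} → Term Γ bool → Term Γ τ → Term Γ τ → Term Γ τ
    pairᵗ        : ∀ {σ τ} → Term Γ σ → Term Γ τ → Term Γ (σ ⊗ τ)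
    fstᵗ         : ∀ {σ τ} → Term Γ (σ ⊗ τ) → Term Γ σ
    sndᵗ         : ∀ {σ τ} → Term Γ (σ ⊗ τ) → Term Γ τ
    atᵗ          : ∀ {τ} → Term Γ (vec τ) → Term Γ idx → Term Γ τ
    eqᵗ          : Term Γ idx → Term Γ idx → Term Γ bool
    leᵗ          : Term Γ (vec bool) → Term Γ (vec bool) → Term Γ bool
    tabᵗ         : ∀ {τ} → Term (idx ∷ Γ) τ → Term Γ (vec τ)
    loopᵗ        : ∀ {τ} → Term (idx ∷ τ ∷ Γ) τ → Term Γ τ → Term Γ τ
    appᵗ         : ∀ {Δ τ} → Term Δ τ → Args Γ Δ → Term Γ τ

  data Args (Γ : Ctx) : Ctx → Set where
    []  : Args Γ []
    _∷_ : ∀ {Δ τ} → Term Γ τ → Args Γ Δ → Args Γ (τ ∷ Δ)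

get : ∀ {Γ τ n} → Var Γ τ → Env Γ n → ⟦ τ ⟧ n
get here      (v , ρ) = v
get (there p) (v , ρ) = get p ρ

mutual
  den : ∀ {Γ τ n} → Term Γ τ → Env Γ n → ⟦ τ ⟧ n
  den (var p)       ρ = get p ρ
  den trueᵗ         ρ = true
  den falseᵗ        ρ = false
  den (condᵗ c a b) ρ = if den c ρ then den a ρ else den b ρ
  den (pairᵗ a b)   ρ = den a ρ , den b ρ
  den (fstᵗ a)      ρ = proj₁ (den a ρ)
  den (sndᵗ a)      ρ = proj₂ (den a ρ)
  den (atᵗ a i)     ρ = den a ρ (den i ρ)
  den (eqᵗ i j)     ρ = does (den i ρ ≟ den j ρ)
  den (leᵗ a b)     ρ = card (den a ρ) ≤ᵇ card (den b ρ)
  den (tabᵗ t)      ρ = λ i → den t (i , ρ)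
  den (loopᵗ t a)   ρ = fold (λ i acc → den t (i , acc , ρ)) (den a ρ)
  den (appᵗ f ts)   ρ = den f (dens ts ρ)

  dens : ∀ {Γ Δ n} → Args Γ Δ → Env Γ n → Env Δ n
  dens []       ρ = tt
  dens (t ∷ ts) ρ = den t ρ , dens ts ρ

-- Values as trees; an environment is a nested tuple that ends in n in unary

unary : ℕ → Tree
unary zero    = nil
unary (suc k) = nil ∙ unary k

encode : ∀ τ {n} → ⟦ τ ⟧ n → Tree
encode bool    b       = encodeBit b
encode idx     i       = unary (toℕ i)
encode (vec τ) f       = encodeList (tabulate (λ i → encode τ (f i)))
encode (σ ⊗ τ) (a , b) = encode σ a ∙ encode τ b

encodeEnv : ∀ {n} Γ → Env Γ n → Tree
encodeEnv {n} []      ρ       = unary n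
encodeEnv     (τ ∷ Γ) (v , ρ) = encode τ v ∙ encodeEnv Γ ρ

-- Compilation: every function is unary, and each loop owns one of them

data Shape : Set where
  none one : Shape
  _⊕_      : Shape → Shape → Shape

-- Nested sums let a subterm address its functions by composing the naming `σ` with injections; only
-- the complete program numbers them by `Fin`.
Slot : Shape → Set
Slot none    = ⊥
Slot one     = ⊤
Slot (s ⊕ t) = Slot s ⊎ Slot t

slots : Shape → ℕ
slots none    = 0
slots one     = 1
slots (s ⊕ t) = slots s + slots t

slot→fin : ∀ s → Slot s → Fin (slots s)
slot→fin one     _        = zero
slot→fin (s ⊕ t) (inj₁ i) = join (slots s) (slots t) (inj₁ (slot→fin s i))
slot→fin (s ⊕ t) (inj₂ i) = join (slots s) (slots t) (inj₂ (slot→fin t i))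

fin→slot : ∀ s → Fin (slots s) → Slot s
fin→slot one     _ = tt
fin→slot (s ⊕ t) i = [ inj₁ ∘ fin→slot s , inj₂ ∘ fin→slot t ]′ (splitAt (slots s) i)

fin→slot→fin : ∀ s i → fin→slot s (slot→fin s i) ≡ i
fin→slot→fin one     tt = refl
fin→slot→fin (s ⊕ t) (inj₁ i)
  rewrite splitAt-join (slots s) (slots t) (inj₁ (slot→fin s i)) = cong inj₁ (fin→slot→fin s i)
fin→slot→fin (s ⊕ t) (inj₂ i)
  rewrite splitAt-join (slots s) (slots t) (inj₂ (slot→fin t i)) = cong inj₂ (fin→slot→fin t i)

mutual
  shape : ∀ {Γ τ} → Term Γ τ → Shape
  shape (var p)       = none
  shape trueᵗ         = none
  shape falseᵗ        = none
  shape (condᵗ c a b) = shape c ⊕ (shape a ⊕ shape b)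
  shape (pairᵗ a b)   = shape a ⊕ shape b
  shape (fstᵗ a)      = shape a
  shape (sndᵗ a)      = shape a
  shape (atᵗ a i)     = shape a ⊕ shape i
  shape (eqᵗ i j)     = shape i ⊕ shape j
  shape (leᵗ a b)     = shape a ⊕ shape b
  shape (tabᵗ t)      = one ⊕ shape t
  shape (loopᵗ t a)   = one ⊕ (shape t ⊕ shape a)
  shape (appᵗ f ts)   = shape f ⊕ shapes ts

  shapes : ∀ {Γ Δ} → Args Γ Δ → Shape
  shapes []       = none
  shapes (t ∷ ts) = shape t ⊕ shapes ts

Code : ℕ → ℕ → Set
Code m = Expr (replicate m 1)

-- For a variable `f` the arity `lookup (replicate m 1) f` equals 1 only propositionally, hence the
-- transport.
call₁ : ∀ {m k} → Fin m → Code m k → Code m k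
call₁ {m} {k} f e = call f (subst (Vec (Code m k)) (sym (lookup-replicate f 1)) (e ∷ []))

pattern #0 = zero
pattern #1 = suc #0
pattern #2 = suc #1
pattern #3 = suc #2
pattern #4 = suc #3
pattern #5 = suc #4
pattern #6 = suc #5
pattern #7 = suc #6

data Helper : Set where
  atʰ eqʰ leʰ : Helper

module Compile {m : ℕ} (helper : Helper → Fin m) where

  -- `leʰ` skips entries `false` of either list and cancels entries `true` in pairs, so it compares
  -- cardinalities without computing them.
  helperCode : Helper → Code m 1
  helperCode atʰ =
    match (var #0) nil
      (match (var #0) nil
        (match (var #3) (var #0)
          (call₁ (helper atʰ) (cons (var #3) (var #1)))))
  helperCode eqʰ =
    match (var #0) nil
      (match (var #0)
        (match (var #1) (cons nil nil) nil)
        (match (var #3) nil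
          (call₁ (helper eqʰ) (cons (var #3) (var #1)))))
  helperCode leʰ =
    match (var #0) nil
      (match (var #0) (cons nil nil)
        (match (var #0) (call₁ (helper leʰ) (cons (var #1) (var #3)))
          (match (var #5) nil
            (match (var #0)
              (call₁ (helper leʰ) (cons (var #6) (var #1)))
              (call₁ (helper leʰ) (cons (var #7) (var #3)))))))

  fetch : ∀ {Γ τ k} → Var Γ τ → Fin k → Code m k
  fetch here      x = match (var x) nil (var #0)
  fetch (there p) x = match (var x) nil (fetch p #1)

  fetchSize : ∀ {k} → Ctx → Fin k → Code m k
  fetchSize []      x = var x
  fetchSize (τ ∷ Γ) x = match (var x) nil (fetchSize Γ #1)

  mutual
    -- The variable `x` holds the whole encoded environment as one tree, so a compiled loop is a
    -- unary function whatever its context.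
    compile : ∀ {Γ τ k} (t : Term Γ τ) → (Slot (shape t) → Fin m) → Fin k → Code m k
    compile (var p)       σ x = fetch p x
    compile trueᵗ         σ x = cons nil nil
    compile falseᵗ        σ x = nil
    compile (condᵗ c a b) σ x =
      match (compile c (σ ∘ inj₁) x) (compile b (σ ∘ inj₂ ∘ inj₂) x)
            (compile a (σ ∘ inj₂ ∘ inj₁) (suc (suc x)))
    compile (pairᵗ a b)   σ x = cons (compile a (σ ∘ inj₁) x) (compile b (σ ∘ inj₂) x)
    compile (fstᵗ a)      σ x = match (compile a σ x) nil (var #0)
    compile (sndᵗ a)      σ x = match (compile a σ x) nil (var #1)
    compile (atᵗ a i)     σ x =
      call₁ (helper atʰ) (cons (compile a (σ ∘ inj₁) x) (compile i (σ ∘ inj₂) x))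
    compile (eqᵗ i j)     σ x =
      call₁ (helper eqʰ) (cons (compile i (σ ∘ inj₁) x) (compile j (σ ∘ inj₂) x))
    compile (leᵗ a b)     σ x =
      call₁ (helper leʰ) (cons (compile a (σ ∘ inj₁) x) (compile b (σ ∘ inj₂) x))
    compile {Γ} (tabᵗ t)    σ x =
      call₁ (σ (inj₁ tt)) (cons (fetchSize Γ x) (cons nil (var x)))
    compile {Γ} (loopᵗ t a) σ x =
      call₁ (σ (inj₁ tt)) (cons (fetchSize Γ x) (cons (compile a (σ ∘ inj₂ ∘ inj₂) x) (var x)))
    compile (appᵗ f ts)   σ x =
      bind (compileArgs ts (σ ∘ inj₂) x) (compile f (σ ∘ inj₁) #0)

    compileArgs : ∀ {Γ Δ k} (ts : Args Γ Δ) → (Slot (shapes ts) → Fin m) → Fin k → Code m k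
    compileArgs {Γ} []  σ x = fetchSize Γ x
    compileArgs (t ∷ ts) σ x = cons (compile t (σ ∘ inj₁) x) (compileArgs ts (σ ∘ inj₂) x)

  -- The argument is counter ∙ (accumulator ∙ environment); the counter runs
  -- down, and the index handed to the loop body is its predecessor.
  tabCode : ∀ {Γ τ} (t : Term (idx ∷ Γ) τ) → (Slot (shape (tabᵗ t)) → Fin m) → Code m 1
  tabCode t σ =
    match (var #0) nil (match (var #1) nil (match (var #2) (var #0)
      (bind (cons (var #1) (var #3))
        (bind (compile t (σ ∘ inj₂) #0)
          (call₁ (σ (inj₁ tt)) (cons (var #3) (cons (cons (var #0) (var #4)) (var #5))))))))

  loopCode : ∀ {Γ τ} (t : Term (idx ∷ τ ∷ Γ) τ) (a : Term Γ τ) →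
             (Slot (shape (loopᵗ t a)) → Fin m) → Code m 1
  loopCode t a σ =
    match (var #0) nil (match (var #1) nil (match (var #2) (var #0)
      (bind (cons (var #1) (cons (var #2) (var #3)))
        (bind (compile t (σ ∘ inj₂ ∘ inj₁) #0)
          (call₁ (σ (inj₁ tt)) (cons (var #3) (cons (var #0) (var #5))))))))

  mutual
    slotCode : ∀ {Γ τ} (t : Term Γ τ) → (Slot (shape t) → Fin m) → Slot (shape t) → Code m 1
    slotCode (condᵗ c a b) σ (inj₁ s)        = slotCode c (σ ∘ inj₁) s
    slotCode (condᵗ c a b) σ (inj₂ (inj₁ s)) = slotCode a (σ ∘ inj₂ ∘ inj₁) s
    slotCode (condᵗ c a b) σ (inj₂ (inj₂ s)) = slotCode b (σ ∘ inj₂ ∘ inj₂) s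
    slotCode (pairᵗ a b)   σ (inj₁ s)        = slotCode a (σ ∘ inj₁) s
    slotCode (pairᵗ a b)   σ (inj₂ s)        = slotCode b (σ ∘ inj₂) s
    slotCode (fstᵗ a)      σ s               = slotCode a σ s
    slotCode (sndᵗ a)      σ s               = slotCode a σ s
    slotCode (atᵗ a i)     σ (inj₁ s)        = slotCode a (σ ∘ inj₁) s
    slotCode (atᵗ a i)     σ (inj₂ s)        = slotCode i (σ ∘ inj₂) s
    slotCode (eqᵗ i j)     σ (inj₁ s)        = slotCode i (σ ∘ inj₁) s
    slotCode (eqᵗ i j)     σ (inj₂ s)        = slotCode j (σ ∘ inj₂) s
    slotCode (leᵗ a b)     σ (inj₁ s)        = slotCode a (σ ∘ inj₁) s
    slotCode (leᵗ a b)     σ (inj₂ s)        = slotCode b (σ ∘ inj₂) s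
    slotCode (tabᵗ t)      σ (inj₁ _)        = tabCode t σ
    slotCode (tabᵗ t)      σ (inj₂ s)        = slotCode t (σ ∘ inj₂) s
    slotCode (loopᵗ t a)   σ (inj₁ _)        = loopCode t a σ
    slotCode (loopᵗ t a)   σ (inj₂ (inj₁ s)) = slotCode t (σ ∘ inj₂ ∘ inj₁) s
    slotCode (loopᵗ t a)   σ (inj₂ (inj₂ s)) = slotCode a (σ ∘ inj₂ ∘ inj₂) s
    slotCode (appᵗ f ts)   σ (inj₁ s)        = slotCode f (σ ∘ inj₁) s
    slotCode (appᵗ f ts)   σ (inj₂ s)        = slotCodes ts (σ ∘ inj₂) s

    slotCodes : ∀ {Γ Δ} (ts : Args Γ Δ) → (Slot (shapes ts) → Fin m) → Slot (shapes ts) → Code m 1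
    slotCodes (t ∷ ts) σ (inj₁ s) = slotCode t (σ ∘ inj₁) s
    slotCodes (t ∷ ts) σ (inj₂ s) = slotCodes ts (σ ∘ inj₂) s

-- Cost bounds read off the syntax

varCost : ∀ {Γ τ} → Var Γ τ → ℕ
varCost here      = 3
varCost (there p) = 2 + varCost p

sizeCost : Ctx → ℕ
sizeCost []      = 1
sizeCost (τ ∷ Γ) = 2 + sizeCost Γ

mutual
  -- The constants are rounded up: a recursive step of a helper costs at most 14 and a loop
  -- iteration 19 beyond its body, and 20 dominates both. A conditional is charged for both
  -- branches, the sum standing in for the maximum.
  cost : ∀ {Γ τ} → Term Γ τ → Poly
  cost (var p)       = constant (varCost p)
  cost trueᵗ         = constant 3
  cost falseᵗ        = constant 1
  cost (condᵗ c a b) = constant 1 :+ cost c :+ (cost a :+ cost b)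
  cost (pairᵗ a b)   = constant 1 :+ cost a :+ cost b
  cost (fstᵗ a)      = constant 1 :+ cost a :+ constant 1
  cost (sndᵗ a)      = constant 1 :+ cost a :+ constant 1
  cost (atᵗ a i)     = constant 1 :+ (constant 1 :+ cost a :+ cost i) :+ constant 20 :* X
  cost (eqᵗ i j)     = constant 1 :+ (constant 1 :+ cost i :+ cost j) :+ (constant 20 :* X :+ constant 10)
  cost (leᵗ a b)     = constant 1 :+ (constant 1 :+ cost a :+ cost b) :+ (constant 20 :* (X :+ X) :+ constant 7)
  cost {Γ} (tabᵗ t)  =
    constant (1 + (1 + sizeCost Γ + 3)) :+ (X :* (constant 20 :+ cost t) :+ constant 7)
  cost {Γ} (loopᵗ t a) =
    constant 1 :+ (constant (1 + sizeCost Γ) :+ (constant 1 :+ cost a :+ constant 1)) :+ (X :* (constant 20 :+ cost t) :+ constant 7)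
  cost (appᵗ f ts)   = constant 1 :+ costs ts :+ cost f

  costs : ∀ {Γ Δ} → Args Γ Δ → Poly
  costs {Γ} []   = constant (sizeCost Γ)
  costs (t ∷ ts) = constant 1 :+ cost t :+ costs ts

suc-≤ᵇ : ∀ a b → (suc a ≤ᵇ suc b) ≡ (a ≤ᵇ b)
suc-≤ᵇ zero    b = refl
suc-≤ᵇ (suc a) b = refl

-- Correctness and cost of compiled code

module Correct {m : ℕ} (helper : Helper → Fin m) (fn : Fin m → Code m 1)
               (helper-ok : ∀ h → fn (helper h) ≡ Compile.helperCode helper h) where

  open Compile helper

  body₁ : (f : Fin m) → Code m (lookup (replicate m 1) f)
  body₁ f = subst (Code m) (sym (lookup-replicate f 1)) (fn f)

  open Evaluation body₁ public

  infix 4 _⊢_↓_within_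

  -- Exact costs depend on the data; upper bounds compose along the syntax.
  _⊢_↓_within_ : ∀ {k} → Vec Tree k → Code m k → Tree → ℕ → Set
  ρ ⊢ e ↓ v within b = ∃[ t ] (ρ ⊢ e ⇓ v [ t ] × t ≤ b)

  private
    subst-⇓ : ∀ {a} (p : 1 ≡ a) (c : Code m 1) {v w t} → v ∷ [] ⊢ c ⇓ w [ t ] →
              subst (Vec Tree) p (v ∷ []) ⊢ subst (Code m) p c ⇓ w [ t ]
    subst-⇓ refl c d = d

    subst-⇓* : ∀ {a k} {ρ : Vec Tree k} (p : 1 ≡ a) (e : Code m k) {v t} → ρ ⊢ e ⇓ v [ t ] →
               ρ ⊢ subst (Vec (Code m k)) p (e ∷ []) ⇓* subst (Vec Tree) p (v ∷ []) [ t + 0 ]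
    subst-⇓* refl e d = d ∷ []

  module _ {k} {ρ : Vec Tree k} where

    weaken : ∀ {e v b c} → b ≤ c → ρ ⊢ e ↓ v within b → ρ ⊢ e ↓ v within c
    weaken b≤c (t , d , t≤b) = t , d , ≤-trans t≤b b≤c

    returns : ∀ {e v w b} → v ≡ w → ρ ⊢ e ↓ v within b → ρ ⊢ e ↓ w within b
    returns refl d = d

    var↓ : ∀ i → ρ ⊢ var i ↓ lookup ρ i within 1
    var↓ i = 1 , var i , ≤-refl

    nil↓ : ρ ⊢ nil ↓ nil within 1
    nil↓ = 1 , nil , ≤-refl

    cons↓ : ∀ {e e′ v v′ b b′} → ρ ⊢ e ↓ v within b → ρ ⊢ e′ ↓ v′ within b′ →
            ρ ⊢ cons e e′ ↓ v ∙ v′ within 1 + b + b′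
    cons↓ (t , d , p) (t′ , d′ , p′) = 1 + t + t′ , cons d d′ , s≤s (+-mono-≤ p p′)

    match-nil↓ : ∀ {e e₁ e₂ v b b′} → ρ ⊢ e ↓ nil within b → ρ ⊢ e₁ ↓ v within b′ →
                 ρ ⊢ match e e₁ e₂ ↓ v within 1 + b + b′
    match-nil↓ (t , d , p) (t′ , d′ , p′) = 1 + t + t′ , match-nil d d′ , s≤s (+-mono-≤ p p′)

    match-∙↓ : ∀ {e e₁ e₂ l r v b b′} → ρ ⊢ e ↓ l ∙ r within b → l ∷ r ∷ ρ ⊢ e₂ ↓ v within b′ →
               ρ ⊢ match e e₁ e₂ ↓ v within 1 + b + b′
    match-∙↓ (t , d , p) (t′ , d′ , p′) = 1 + t + t′ , match-∙ d d′ , s≤s (+-mono-≤ p p′)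

    bind↓ : ∀ {e e₁ v w b b′} → ρ ⊢ e ↓ v within b → v ∷ ρ ⊢ e₁ ↓ w within b′ →
            ρ ⊢ bind e e₁ ↓ w within 1 + b + b′
    bind↓ (t , d , p) (t′ , d′ , p′) = 1 + t + t′ , bind d d′ , s≤s (+-mono-≤ p p′)

    call↓ : ∀ {f c e v w b b′} → fn f ≡ c → ρ ⊢ e ↓ v within b → v ∷ [] ⊢ c ↓ w within b′ →
            ρ ⊢ call₁ f e ↓ w within 1 + b + b′
    call↓ {f} refl (t , d , p) (t′ , d′ , p′) =
      1 + (t + 0) + t′ ,
      call (subst-⇓* 1≡ _ d) (subst-⇓ 1≡ (fn f) d′) ,
      s≤s (+-mono-≤ (≤-trans (≤-reflexive (+-identityʳ t)) p) p′)
      where 1≡ = sym (lookup-replicate f 1)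

  private
    self : ∀ {h k} {ρ : Vec Tree k} {e v w b b′} → ρ ⊢ e ↓ v within b →
           v ∷ [] ⊢ helperCode h ↓ w within b′ → ρ ⊢ call₁ (helper h) e ↓ w within 1 + b + b′
    self {h} = call↓ (helper-ok h)

  at↓ : ∀ {k} (f : Fin k → Tree) (i : Fin k) →
        (encodeList (tabulate f) ∙ unary (toℕ i)) ∷ [] ⊢ helperCode atʰ ↓ f i within 20 * k
  at↓ {suc k} f zero = weaken (*-mono-≤ {7} {20} {1} {suc k} (m≤m+n 7 13) (s≤s z≤n))
    (match-∙↓ (var↓ _) (match-∙↓ (var↓ _) (match-nil↓ (var↓ _) (var↓ _))))
  at↓ {suc k} f (suc i) = weaken (bound k)
    (match-∙↓ (var↓ _) (match-∙↓ (var↓ _) (match-∙↓ (var↓ _)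
      (self (cons↓ (var↓ _) (var↓ _)) (at↓ (f ∘ suc) i)))))
    where
    eqn : ∀ k → 10 + 20 * k + 10 ≡ 20 * suc k
    eqn = solve-∀
    bound : ∀ k → 10 + 20 * k ≤ 20 * suc k
    bound k = ≤-trans (m≤m+n _ 10) (≤-reflexive (eqn k))

  private
    step20 : ∀ a {b} k c → a + b ≡ 20 → a + (20 * k + c) ≤ 20 * suc k + c
    step20 a {b} k c e = begin
      a + (20 * k + c)        ≤⟨ +-monoˡ-≤ (20 * k + c) (m≤m+n a b) ⟩
      a + b + (20 * k + c)    ≡⟨ cong (_+ (20 * k + c)) e ⟩
      20 + (20 * k + c)       ≡⟨ eqn k c ⟩
      20 * suc k + c          ∎
      where
      open ≤-Reasoning
      eqn : ∀ k c → 20 + (20 * k + c) ≡ 20 * suc k + c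
      eqn = solve-∀

  eq↓ : ∀ {k} (i j : Fin k) →
        (unary (toℕ i) ∙ unary (toℕ j)) ∷ [] ⊢ helperCode eqʰ ↓ encodeBit (does (i ≟ j)) within 20 * k + 10
  eq↓ {suc k} zero zero = weaken (≤-trans (m≤m+n 9 1) (m≤n+m 10 (20 * suc k)))
    (match-∙↓ (var↓ _) (match-nil↓ (var↓ _) (match-nil↓ (var↓ _) (cons↓ nil↓ nil↓))))
  eq↓ {suc k} zero (suc j) = weaken (≤-trans (m≤m+n 7 3) (m≤n+m 10 (20 * suc k)))
    (match-∙↓ (var↓ _) (match-nil↓ (var↓ _) (match-∙↓ (var↓ _) nil↓)))
  eq↓ {suc k} (suc i) zero = weaken (≤-trans (m≤m+n 7 3) (m≤n+m 10 (20 * suc k)))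
    (match-∙↓ (var↓ _) (match-∙↓ (var↓ _) (match-nil↓ (var↓ _) nil↓)))
  eq↓ {suc k} (suc i) (suc j) = weaken (step20 10 k 10 refl)
    (match-∙↓ (var↓ _) (match-∙↓ (var↓ _) (match-∙↓ (var↓ _)
      (self (cons↓ (var↓ _) (var↓ _)) (eq↓ i j)))))

  le↓ : ∀ {j k} (f : Fin j → Bool) (g : Fin k → Bool) →
        (encodeList (tabulate (encodeBit ∘ f)) ∙ encodeList (tabulate (encodeBit ∘ g))) ∷ []
        ⊢ helperCode leʰ ↓ encodeBit (card f ≤ᵇ card g) within 20 * (j + k) + 7
  le↓ {zero} {k} f g = weaken (m≤n+m 7 (20 * k))
    (match-∙↓ (var↓ _) (match-nil↓ (var↓ _) (cons↓ nil↓ nil↓)))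
  le↓ {suc j} {zero} f g with f zero
  ... | false = weaken (step20 10 (j + 0) 7 refl)
    (match-∙↓ (var↓ _) (match-∙↓ (var↓ _) (match-nil↓ (var↓ _)
      (self (cons↓ (var↓ _) (var↓ _)) (le↓ (f ∘ suc) g)))))
  ... | true = weaken (≤-trans (m≤m+n 9 (11 + (20 * (j + 0) + 7))) (step20 20 (j + 0) 7 refl))
    (match-∙↓ (var↓ _) (match-∙↓ (var↓ _) (match-∙↓ (var↓ _) (match-nil↓ (var↓ _) nil↓))))
  -- The types of the recursive results mention `f zero` or `g zero` through `card` and the encoded
  -- lists, so these results are abstracted together with the two bits.
  le↓ {suc j} {suc k} f g with f zero | g zero | le↓ f (g ∘ suc) | le↓ (f ∘ suc) g
  ... | false | _ | _ | rec = weaken (step20 10 (j + suc k) 7 refl)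
    (match-∙↓ (var↓ _) (match-∙↓ (var↓ _) (match-nil↓ (var↓ _)
      (self (cons↓ (var↓ _) (var↓ _)) rec))))
  ... | true | false | rec | _ = weaken (≤-trans (step20 14 (suc j + k) 7 refl) (≤-reflexive (eqn j k)))
    (match-∙↓ (var↓ _) (match-∙↓ (var↓ _) (match-∙↓ (var↓ _) (match-∙↓ (var↓ _) (match-nil↓ (var↓ _)
      (self (cons↓ (var↓ _) (var↓ _)) rec))))))
    where
    eqn : ∀ j k → 20 * suc (suc j + k) + 7 ≡ 20 * (suc j + suc k) + 7
    eqn = solve-∀
  ... | true | true | _ | _ rewrite suc-≤ᵇ (card (f ∘ suc)) (card (g ∘ suc)) =
    weaken (≤-trans (step20 14 (j + k) 7 refl) (≤-trans (m≤m+n _ 20) (≤-reflexive (eqn j k))))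
    (match-∙↓ (var↓ _) (match-∙↓ (var↓ _) (match-∙↓ (var↓ _) (match-∙↓ (var↓ _) (match-∙↓ (var↓ _)
      (self (cons↓ (var↓ _) (var↓ _)) (le↓ (f ∘ suc) (g ∘ suc))))))))
    where
    eqn : ∀ j k → 20 * suc (j + k) + 7 + 20 ≡ 20 * (suc j + suc k) + 7
    eqn = solve-∀

  fetch↓ : ∀ {Γ τ n k} (p : Var Γ τ) (ρ : Env Γ n) {δ : Vec Tree k} (x : Fin k) →
           lookup δ x ≡ encodeEnv Γ ρ → δ ⊢ fetch p x ↓ encode τ (get p ρ) within varCost p
  fetch↓ here      (v , ρ) {δ} x e = match-∙↓ (returns e (var↓ x)) (var↓ _)
  fetch↓ (there p) (v , ρ) {δ} x e =
    match-∙↓ (returns e (var↓ x)) (fetch↓ p ρ #1 refl)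

  fetchSize↓ : ∀ Γ {n k} (ρ : Env Γ n) {δ : Vec Tree k} (x : Fin k) →
               lookup δ x ≡ encodeEnv Γ ρ → δ ⊢ fetchSize Γ x ↓ unary n within sizeCost Γ
  fetchSize↓ []      ρ       {δ} x e = returns e (var↓ x)
  fetchSize↓ (τ ∷ Γ) (v , ρ) {δ} x e =
    match-∙↓ (returns e (var↓ x)) (fetchSize↓ Γ ρ #1 refl)

  Linked : ∀ s → (Slot s → Fin m) → (Slot s → Code m 1) → Set
  Linked s σ c = ∀ i → fn (σ i) ≡ c i

  Computes : ∀ {Γ τ} (n : ℕ) (t : Term Γ τ) → (Slot (shape t) → Fin m) → Set
  Computes {Γ} {τ} n t σ =
    ∀ (ρ : Env Γ n) {k} {δ : Vec Tree k} (x : Fin k) → lookup δ x ≡ encodeEnv Γ ρ →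
    δ ⊢ compile t σ x ↓ encode τ (den t ρ) within eval (cost t) n

  private
    iteration : ∀ b k → 20 + b + (k * (20 + b) + 7) ≡ suc k * (20 + b) + 7
    iteration b k = sym (+-assoc (20 + b) (k * (20 + b)) 7)

    prepend : ∀ {k} → (Fin k → Tree) → Tree → Tree
    prepend f acc = foldr′ _∙_ acc (tabulate f)

    -- The counter runs down, so a table is built from its last entry to its first, and pushing in
    -- front of the accumulator yields the right order without a reversal.
    prepend-last : ∀ {k} (f : Fin (suc k) → Tree) acc →
                   prepend f acc ≡ prepend (f ∘ inject₁) (f (fromℕ k) ∙ acc)
    prepend-last {zero}  f acc = refl
    prepend-last {suc k} f acc = cong (f zero ∙_) (prepend-last (f ∘ suc) acc)

  module _ {Γ : Ctx} {τ : Ty} {n : ℕ} (ρ : Env Γ n) where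

    -- The induction is on the counter `k`, while the body expects an index in `Fin n`. The
    -- embedding `g`, which preserves `toℕ` and hence the unary code, mediates; the compiled call
    -- starts with the identity.
    tab↓ : (t : Term (idx ∷ Γ) τ) (σ : Slot (shape (tabᵗ t)) → Fin m) →
           fn (σ (inj₁ tt)) ≡ tabCode t σ → Computes n t (σ ∘ inj₂) →
           ∀ {k} (g : Fin k → Fin n) → (∀ i → toℕ (g i) ≡ toℕ i) → ∀ acc →
           (unary k ∙ acc ∙ encodeEnv Γ ρ) ∷ [] ⊢ tabCode t σ
           ↓ prepend (λ i → encode τ (den t (g i , ρ))) acc within k * (20 + eval (cost t) n) + 7
    tab↓ t σ ok comp {zero}  g g≡ acc =
      match-∙↓ (var↓ _) (match-∙↓ (var↓ _) (match-nil↓ (var↓ _) (var↓ _)))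
    tab↓ t σ ok comp {suc k} g g≡ acc =
      returns (sym (prepend-last (λ i → encode τ (den t (g i , ρ))) acc))
      (weaken bound
        (match-∙↓ (var↓ _) (match-∙↓ (var↓ _) (match-∙↓ (var↓ _)
          (bind↓ (cons↓ (var↓ _) (var↓ _)) (bind↓ (comp (g (fromℕ k) , ρ) #0 env≡)
            (call↓ ok (cons↓ (var↓ _) (cons↓ (cons↓ (var↓ _) (var↓ _)) (var↓ _)))
              (tab↓ t σ ok comp (g ∘ inject₁) (λ i → trans (g≡ (inject₁ i)) (toℕ-inject₁ i)) _))))))))
      where
      env≡ : unary k ∙ encodeEnv Γ ρ ≡ unary (toℕ (g (fromℕ k))) ∙ encodeEnv Γ ρ
      env≡ = cong (λ i → unary i ∙ encodeEnv Γ ρ) (sym (trans (g≡ (fromℕ k)) (toℕ-fromℕ k)))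
      eqn : ∀ b r → 6 + (1 + 3 + (1 + b + (1 + 7 + r))) ≡ 19 + b + r
      eqn = solve-∀
      bound : ∀ {b} → 6 + (1 + 3 + (1 + b + (1 + 7 + (k * (20 + b) + 7)))) ≤ suc k * (20 + b) + 7
      bound {b} = ≤-trans (≤-trans (≤-reflexive (eqn b _)) (n≤1+n _)) (≤-reflexive (iteration b k))

    loop↓ : (t : Term (idx ∷ τ ∷ Γ) τ) (a : Term Γ τ) (σ : Slot (shape (loopᵗ t a)) → Fin m) →
            fn (σ (inj₁ tt)) ≡ loopCode t a σ → Computes n t (σ ∘ inj₂ ∘ inj₁) →
            ∀ {k} (g : Fin k → Fin n) → (∀ i → toℕ (g i) ≡ toℕ i) → ∀ acc →
            (unary k ∙ encode τ acc ∙ encodeEnv Γ ρ) ∷ [] ⊢ loopCode t a σ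
            ↓ encode τ (fold (λ i b → den t (g i , b , ρ)) acc) within k * (20 + eval (cost t) n) + 7
    loop↓ t a σ ok comp {zero}  g g≡ acc =
      match-∙↓ (var↓ _) (match-∙↓ (var↓ _) (match-nil↓ (var↓ _) (var↓ _)))
    loop↓ t a σ ok comp {suc k} g g≡ acc =
      weaken bound
        (match-∙↓ (var↓ _) (match-∙↓ (var↓ _) (match-∙↓ (var↓ _)
          (bind↓ (cons↓ (var↓ _) (cons↓ (var↓ _) (var↓ _))) (bind↓ (comp (g (fromℕ k) , acc , ρ) #0 env≡)
            (call↓ ok (cons↓ (var↓ _) (cons↓ (var↓ _) (var↓ _)))
              (loop↓ t a σ ok comp (g ∘ inject₁) (λ i → trans (g≡ (inject₁ i)) (toℕ-inject₁ i)) _)))))))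
      where
      env≡ : unary k ∙ encode τ acc ∙ encodeEnv Γ ρ ≡ unary (toℕ (g (fromℕ k))) ∙ encode τ acc ∙ encodeEnv Γ ρ
      env≡ = cong (λ i → unary i ∙ encode τ acc ∙ encodeEnv Γ ρ) (sym (trans (g≡ (fromℕ k)) (toℕ-fromℕ k)))
      eqn : ∀ b r → 6 + (1 + 5 + (1 + b + (1 + 5 + r))) ≡ 19 + b + r
      eqn = solve-∀
      bound : ∀ {b} → 6 + (1 + 5 + (1 + b + (1 + 5 + (k * (20 + b) + 7)))) ≤ suc k * (20 + b) + 7
      bound {b} = ≤-trans (≤-trans (≤-reflexive (eqn b _)) (n≤1+n _)) (≤-reflexive (iteration b k))

  mutual
    compile↓ : ∀ {Γ τ n} (t : Term Γ τ) (σ : Slot (shape t) → Fin m) →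
               Linked (shape t) σ (slotCode t σ) → Computes n t σ
    compile↓ (var p)       σ ok ρ x e = fetch↓ p ρ x e
    compile↓ trueᵗ         σ ok ρ x e = cons↓ nil↓ nil↓
    compile↓ falseᵗ        σ ok ρ x e = nil↓
    compile↓ {n = n} (condᵗ c a b) σ ok ρ x e
      with den c ρ | compile↓ c (σ ∘ inj₁) (ok ∘ inj₁) ρ x e
    ... | false | d = weaken (+-monoʳ-≤ (1 + eval (cost c) n) (m≤n+m _ (eval (cost a) n)))
      (match-nil↓ d (compile↓ b (σ ∘ inj₂ ∘ inj₂) (ok ∘ inj₂ ∘ inj₂) ρ x e))
    ... | true  | d = weaken (+-monoʳ-≤ (1 + eval (cost c) n) (m≤m+n (eval (cost a) n) _))
      (match-∙↓ d (compile↓ a (σ ∘ inj₂ ∘ inj₁) (ok ∘ inj₂ ∘ inj₁) ρ (suc (suc x)) e))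
    compile↓ (pairᵗ a b)   σ ok ρ x e =
      cons↓ (compile↓ a (σ ∘ inj₁) (ok ∘ inj₁) ρ x e) (compile↓ b (σ ∘ inj₂) (ok ∘ inj₂) ρ x e)
    compile↓ (fstᵗ a)      σ ok ρ x e = match-∙↓ (compile↓ a σ ok ρ x e) (var↓ _)
    compile↓ (sndᵗ a)      σ ok ρ x e = match-∙↓ (compile↓ a σ ok ρ x e) (var↓ _)
    compile↓ {τ = τ} (atᵗ a i)     σ ok ρ x e =
      self (cons↓ (compile↓ a (σ ∘ inj₁) (ok ∘ inj₁) ρ x e)
                  (compile↓ i (σ ∘ inj₂) (ok ∘ inj₂) ρ x e))
           (at↓ (λ i → encode τ (den a ρ i)) (den i ρ))
    compile↓ (eqᵗ i j)     σ ok ρ x e =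
      self (cons↓ (compile↓ i (σ ∘ inj₁) (ok ∘ inj₁) ρ x e)
                  (compile↓ j (σ ∘ inj₂) (ok ∘ inj₂) ρ x e))
           (eq↓ (den i ρ) (den j ρ))
    compile↓ (leᵗ a b)     σ ok ρ x e =
      self (cons↓ (compile↓ a (σ ∘ inj₁) (ok ∘ inj₁) ρ x e)
                  (compile↓ b (σ ∘ inj₂) (ok ∘ inj₂) ρ x e))
           (le↓ (den a ρ) (den b ρ))
    compile↓ {Γ} (tabᵗ t)    σ ok ρ {δ = δ} x e =
      call↓ (ok (inj₁ tt))
        (cons↓ (fetchSize↓ Γ ρ x e) (cons↓ nil↓ (returns e (var↓ x))))
        (tab↓ ρ t σ (ok (inj₁ tt)) (compile↓ t (σ ∘ inj₂) (ok ∘ inj₂)) id (λ _ → refl) nil)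
    compile↓ {Γ} (loopᵗ t a) σ ok ρ {δ = δ} x e =
      call↓ (ok (inj₁ tt))
        (cons↓ (fetchSize↓ Γ ρ x e)
          (cons↓ (compile↓ a (σ ∘ inj₂ ∘ inj₂) (ok ∘ inj₂ ∘ inj₂) ρ x e)
                 (returns e (var↓ x))))
        (loop↓ ρ t a σ (ok (inj₁ tt)) (compile↓ t (σ ∘ inj₂ ∘ inj₁) (ok ∘ inj₂ ∘ inj₁))
          id (λ _ → refl) (den a ρ))
    compile↓ (appᵗ f ts)   σ ok ρ x e =
      bind↓ (compileArgs↓ ts (σ ∘ inj₂) (ok ∘ inj₂) ρ x e)
            (compile↓ f (σ ∘ inj₁) (ok ∘ inj₁) (dens ts ρ) #0 refl)

    compileArgs↓ : ∀ {Γ Δ n} (ts : Args Γ Δ) (σ : Slot (shapes ts) → Fin m) →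
                   Linked (shapes ts) σ (slotCodes ts σ) →
                   ∀ (ρ : Env Γ n) {k} {δ : Vec Tree k} (x : Fin k) → lookup δ x ≡ encodeEnv Γ ρ →
                   δ ⊢ compileArgs ts σ x ↓ encodeEnv Δ (dens ts ρ) within eval (costs ts) n
    compileArgs↓ {Γ} []   σ ok ρ x e = fetchSize↓ Γ ρ x e
    compileArgs↓ (t ∷ ts) σ ok ρ x e =
      cons↓ (compile↓ t (σ ∘ inj₁) (ok ∘ inj₁) ρ x e)
            (compileArgs↓ ts (σ ∘ inj₂) (ok ∘ inj₂) ρ x e)

-- Branching programs: a step either returns a final accumulator (flag true), or
-- an accumulator and two states, to be processed one after the other.

pattern #8 = suc #7

data Run {A S : Set} (f : A → S → Bool × A × S × S) : A → S → A → ℕ → Set where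
  leaf : ∀ {a s a′ s₁ s₂} → f a s ≡ (true , a′ , s₁ , s₂) → Run f a s a′ 1
  node : ∀ {a s a₀ a₁ a₂ s₁ s₂ k₁ k₂} → f a s ≡ (false , a₀ , s₁ , s₂) →
         Run f a₀ s₁ a₁ k₁ → Run f a₁ s₂ a₂ k₂ → Run f a s a₂ (1 + k₁ + k₂)

module Branching {σ τ υ : Ty}
  (step : Term (σ ∷ τ ∷ vec υ ∷ []) (bool ⊗ σ ⊗ τ ⊗ τ))
  (init : Args (vec υ ∷ []) (σ ∷ τ ∷ vec υ ∷ [])) where

  stepCost : Poly
  stepCost = constant 50 :+ cost step

  initCost : Poly
  initCost = constant 20 :+ constant 10 :* X :+ costs init

  private
    total : Shape
    total = ((one ⊕ (one ⊕ one)) ⊕ (one ⊕ one)) ⊕ (shape step ⊕ shapes init)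

    fn# : Slot total → Fin (slots total)
    fn# = slot→fin total

    helper : Helper → Fin (slots total)
    helper atʰ = fn# (inj₁ (inj₁ (inj₁ tt)))
    helper eqʰ = fn# (inj₁ (inj₁ (inj₂ (inj₁ tt))))
    helper leʰ = fn# (inj₁ (inj₁ (inj₂ (inj₂ tt))))

    go# len# : Fin (slots total)
    go#  = fn# (inj₁ (inj₂ (inj₁ tt)))
    len# = fn# (inj₁ (inj₂ (inj₂ tt)))

    step# : Slot (shape step) → Fin (slots total)
    step# i = fn# (inj₂ (inj₁ i))

    init# : Slot (shapes init) → Fin (slots total)
    init# i = fn# (inj₂ (inj₂ i))

    open Compile helper

    goCode lenCode : Code (slots total) 1
    goCode =
      match (var #0) nil (match (var #1) nil
        (bind (compile step step# #4)
          (match (var #0) nil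
            (match (var #0)
              (match (var #1) nil (match (var #1) nil
                (call₁ go# (cons (call₁ go# (cons (var #2) (cons (var #0) (var #8))))
                                 (cons (var #1) (var #8))))))
              (match (var #3) nil (var #0))))))
    lenCode = match (var #0) nil (cons nil (call₁ len# (var #1)))

    table : Slot total → Code (slots total) 1
    table (inj₁ (inj₁ (inj₁ tt)))        = helperCode atʰ
    table (inj₁ (inj₁ (inj₂ (inj₁ tt)))) = helperCode eqʰ
    table (inj₁ (inj₁ (inj₂ (inj₂ tt)))) = helperCode leʰ
    table (inj₁ (inj₂ (inj₁ tt)))        = goCode
    table (inj₁ (inj₂ (inj₂ tt)))        = lenCode
    table (inj₂ (inj₁ i))                = slotCode step step# i
    table (inj₂ (inj₂ i))                = slotCodes init init# i

    fn : Fin (slots total) → Code (slots total) 1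
    fn f = table (fin→slot total f)

    fn-ok : ∀ s → fn (fn# s) ≡ table s
    fn-ok s = cong table (fin→slot→fin total s)

    helper-ok : ∀ h → fn (helper h) ≡ helperCode h
    helper-ok atʰ = fn-ok (inj₁ (inj₁ (inj₁ tt)))
    helper-ok eqʰ = fn-ok (inj₁ (inj₁ (inj₂ (inj₁ tt))))
    helper-ok leʰ = fn-ok (inj₁ (inj₁ (inj₂ (inj₂ tt))))

    open Correct helper fn helper-ok

  program : Program
  program = record
    { arities = replicate (slots total) 1
    ; body    = body₁
    ; main    =
        -- The input is a list of n entries, so its length is the unary n that ends every
        -- environment.
        bind (call₁ len# (var #0)) (bind (cons (var #1) (var #0))
          (call₁ go# (compileArgs init init# #0)))
    }

  private
    go-ok : fn go# ≡ goCode
    go-ok = fn-ok (inj₁ (inj₂ (inj₁ tt)))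

    len-ok : fn len# ≡ lenCode
    len-ok = fn-ok (inj₁ (inj₂ (inj₂ tt)))

    len↓ : ∀ {k} (f : Fin k → Tree) →
           encodeList (tabulate f) ∷ [] ⊢ lenCode ↓ unary k within 10 * k + 3
    len↓ {zero}  f = match-nil↓ (var↓ _) nil↓
    len↓ {suc k} f = weaken (≤-trans (m≤m+n _ 4) (≤-reflexive (eqn k)))
      (match-∙↓ (var↓ _) (cons↓ nil↓ (call↓ len-ok (var↓ _) (len↓ (f ∘ suc)))))
      where
      eqn : ∀ k → 6 + (10 * k + 3) + 4 ≡ 10 * suc k + 3
      eqn = solve-∀

    module _ {n} (x : ⟦ vec υ ⟧ n) where

      envTree : ⟦ σ ⟧ n → ⟦ τ ⟧ n → Tree
      envTree a s = encodeEnv {n} (σ ∷ τ ∷ vec υ ∷ []) (a , s , x , tt)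

      outTree : Bool × ⟦ σ ⟧ n × ⟦ τ ⟧ n × ⟦ τ ⟧ n → Tree
      outTree = encode (bool ⊗ σ ⊗ τ ⊗ τ)

      step↓ : ∀ {k} {δ : Vec Tree k} i {a s out} → lookup δ i ≡ envTree a s →
              den step (a , s , x , tt) ≡ out →
              δ ⊢ compile step step# i ↓ outTree out within eval (cost step) n
      step↓ i e refl =
        compile↓ step step# (λ s → fn-ok (inj₂ (inj₁ s))) _ i e

      go↓ : ∀ {a s a′ k} → Run (λ a s → den step (a , s , x , tt)) a s a′ k →
            envTree a s ∷ [] ⊢ goCode ↓ encode σ a′ within k * eval stepCost n
      go↓ (leaf e) = weaken (≤-trans (m≤m+n _ 38) (≤-reflexive (eqn (eval (cost step) n))))
        (match-∙↓ (var↓ _) (match-∙↓ (var↓ _) (bind↓ (step↓ #4 refl e)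
          (match-∙↓ (var↓ _) (match-∙↓ (var↓ _) (match-∙↓ (var↓ _) (var↓ _)))))))
        where
        eqn : ∀ b → 4 + (1 + b + 7) + 38 ≡ 1 * (50 + b)
        eqn = solve-∀
      go↓ (node {k₁ = k₁} {k₂ = k₂} e r₁ r₂) =
        weaken (≤-trans (m≤m+n _ 26) (≤-reflexive (eqn k₁ k₂ (eval (cost step) n))))
        (match-∙↓ (var↓ _) (match-∙↓ (var↓ _) (bind↓ (step↓ #4 refl e)
          (match-∙↓ (var↓ _) (match-nil↓ (var↓ _) (match-∙↓ (var↓ _) (match-∙↓ (var↓ _)
            (call↓ go-ok
              (cons↓ (call↓ go-ok (cons↓ (var↓ _) (cons↓ (var↓ _) (var↓ _))) (go↓ r₁))
                     (cons↓ (var↓ _) (var↓ _)))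
              (go↓ r₂)))))))))
        where
        eqn : ∀ k₁ k₂ b →
              4 + (1 + b + (8 + (1 + (1 + (1 + 5 + k₁ * (50 + b)) + 3) + k₂ * (50 + b)))) + 26
              ≡ (1 + k₁ + k₂) * (50 + b)
        eqn = solve-∀

  program-correct : ∀ {n} (x : ⟦ vec υ ⟧ n) {a₀ s₀ y a k} →
    dens init (x , tt) ≡ (a₀ , s₀ , y , tt) → Run (λ a s → den step (a , s , y , tt)) a₀ s₀ a k →
    program on encode (vec υ) x outputs encode σ a within (eval initCost n + k * eval stepCost n)
  program-correct {n} x {k = k} refl run =
    weaken (≤-trans (m≤m+n _ 9) (≤-reflexive (eqn n (eval (costs init) n) (k * eval stepCost n))))
      (bind↓ (call↓ len-ok (var↓ _) (len↓ _)) (bind↓ (cons↓ (var↓ _) (var↓ _))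
        (call↓ go-ok (compileArgs↓ init init# (λ s → fn-ok (inj₂ (inj₂ s))) (x , tt) #0 refl)
          (go↓ _ run))))
    where
    eqn : ∀ n b r → 1 + (2 + (10 * n + 3)) + (4 + (1 + b + r)) + 9 ≡ 20 + 10 * n + b + r
    eqn = solve-∀

-- The connectives are conditionals, as in the object language, so that terms
-- denote them definitionally.

infixr 6 _&&_
infixr 5 _||_

_&&_ _||_ : Bool → Bool → Bool
a && b = if a then b else false
a || b = if a then true else b

neg : Bool → Bool
neg a = if a then false else true

true-or-false : ∀ b → b ≡ true ⊎ b ≡ false
true-or-false true  = inj₁ refl
true-or-false false = inj₂ refl

absurd : ∀ {A : Set} {b} → b ≡ true → b ≡ false → A
absurd refl ()

not-true : ∀ {b} → ¬ b ≡ true → b ≡ false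
not-true {true}  h = ⊥-elim (h refl)
not-true {false} h = refl

&&-intro : ∀ {a b} → a ≡ true → b ≡ true → a && b ≡ true
&&-intro refl refl = refl

&&-elim : ∀ {a b} → a && b ≡ true → a ≡ true × b ≡ true
&&-elim {true} e = refl , e

||-introˡ : ∀ {a b} → a ≡ true → a || b ≡ true
||-introˡ refl = refl

||-introʳ : ∀ {a b} → b ≡ true → a || b ≡ true
||-introʳ {true}  e = refl
||-introʳ {false} e = e

||-elim : ∀ {a b} → a || b ≡ true → a ≡ true ⊎ b ≡ true
||-elim {true}  e = inj₁ refl
||-elim {false} e = inj₂ e

neg-intro : ∀ {a} → a ≡ false → neg a ≡ true
neg-intro refl = refl

neg-elim : ∀ {a} → neg a ≡ true → a ≡ false
neg-elim {false} e = refl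

neg-false : ∀ {a} → neg a ≡ false → a ≡ true
neg-false {true} e = refl

≤ᵇ-true⇒≤ : ∀ {a b} → (a ≤ᵇ b) ≡ true → a ≤ b
≤ᵇ-true⇒≤ {a} {b} e = ≤ᵇ⇒≤ a b (subst T (sym e) tt)

≤⇒≤ᵇ-true : ∀ {a b} → a ≤ b → (a ≤ᵇ b) ≡ true
≤⇒≤ᵇ-true {a} {b} a≤b with a ≤ᵇ b | ≤⇒≤ᵇ a≤b
... | true | _ = refl

-- Finite sets

BSet : ℕ → Set
BSet n = Fin n → Bool

module _ {n : ℕ} where

  infix 4 _∈ᵇ_ _∉ᵇ_ _⊆ᵇ_
  infix 7 _==_

  _∈ᵇ_ _∉ᵇ_ : Fin n → BSet n → Set
  i ∈ᵇ A = A i ≡ true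
  i ∉ᵇ A = A i ≡ false

  _⊆ᵇ_ : BSet n → BSet n → Set
  A ⊆ᵇ B = ∀ i → i ∈ᵇ A → i ∈ᵇ B

  _==_ : Fin n → Fin n → Bool
  i == j = does (i ≟ j)

  ==-refl : ∀ i → i == i ≡ true
  ==-refl i with i ≟ i
  ... | yes _ = refl
  ... | no  h = ⊥-elim (h refl)

  ==⇒≡ : ∀ {i j} → i == j ≡ true → i ≡ j
  ==⇒≡ {i} {j} e with i ≟ j
  ... | yes p = p

  ≢⇒==-false : ∀ {i j} → i ≢ j → i == j ≡ false
  ≢⇒==-false h = not-true (h ∘ ==⇒≡)

-- Search and quantifiers over finite index sets

pick : ∀ {k} {A : Set} → (Fin k → Bool) → (Fin k → A) → A → A
pick p f d = fold (λ i a → if p i then f i else a) d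

-- The view forgets which index wins, since every choice that the algorithm makes among candidates
-- is arbitrary.
data Picked {k} {A : Set} (p : Fin k → Bool) (f : Fin k → A) (d : A) : A → Set where
  found : ∀ i → p i ≡ true → Picked p f d (f i)
  none  : (∀ i → p i ≡ false) → Picked p f d d

pick-view : ∀ {k} {A : Set} p (f : Fin k → A) d → Picked p f d (pick p f d)
pick-view {zero}  p f d = none λ ()
pick-view {suc k} p f d
  with fold (λ i a → if p (inject₁ i) then f (inject₁ i) else a) (if p (fromℕ k) then f (fromℕ k) else d)
     | pick-view (p ∘ inject₁) (f ∘ inject₁) (if p (fromℕ k) then f (fromℕ k) else d)
... | _ | found i e = found (inject₁ i) e
... | _ | none h with p (fromℕ k) in e
...   | true  = found (fromℕ k) e
...   | false = none none′
  where
  none′ : ∀ i → p i ≡ false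
  none′ i with view i
  ... | ‵fromℕ     = e
  ... | ‵inject₁ j = h j

some every : ∀ {k} → (Fin k → Bool) → Bool
some  p = pick p (λ _ → true) false
every p = neg (some (λ i → neg (p i)))

module _ {k : ℕ} {p : Fin k → Bool} where

  some-elim : some p ≡ true → ∃[ i ] p i ≡ true
  some-elim e with pick p (λ _ → true) false | pick-view p (λ _ → true) false
  ... | _ | found i h = i , h
  some-elim () | _ | none _

  some-intro : ∀ i → p i ≡ true → some p ≡ true
  some-intro i h with pick p (λ _ → true) false | pick-view p (λ _ → true) false
  ... | _ | found _ _ = refl
  ... | _ | none h′   = absurd h (h′ i)

every-elim : ∀ {k} {p : Fin k → Bool} → every p ≡ true → ∀ i → p i ≡ true
every-elim {p = p} e i with true-or-false (p i)
... | inj₁ h = h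
... | inj₂ h = absurd (some-intro i (neg-intro h)) (neg-elim e)

every-intro : ∀ {k} {p : Fin k → Bool} → (∀ i → p i ≡ true) → every p ≡ true
every-intro {p = p} h = neg-intro (not-true λ e → let i , e′ = some-elim e in absurd (h i) (neg-elim e′))

total-refl : ∀ {A : Set} {_≼_ : A → A → Set} → (∀ x y → x ≼ y ⊎ y ≼ x) → ∀ x → x ≼ x
total-refl total x with total x x
... | inj₁ x≼x = x≼x
... | inj₂ x≼x = x≼x

extremum : ∀ {k} (_≼_ : Fin k → Fin k → Set) →
           (∀ {x y z} → x ≼ y → y ≼ z → x ≼ z) → (∀ x y → x ≼ y ⊎ y ≼ x) →
           ∀ (p : Fin k → Bool) i → p i ≡ true → ∃[ m ] (p m ≡ true × ∀ j → p j ≡ true → j ≼ m)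
extremum {suc k} _≼_ tr total p i pi with true-or-false (some (p ∘ suc))
... | inj₂ h = zero , zero-in i pi , λ where
        zero    _ → total-refl total zero
        (suc j) e → absurd (some-intro {p = p ∘ suc} j e) h
  where
  zero-in : ∀ i → p i ≡ true → p zero ≡ true
  zero-in zero    e = e
  zero-in (suc j) e = absurd (some-intro {p = p ∘ suc} j e) h
... | inj₁ h with some-elim {p = p ∘ suc} h
...   | i′ , pi′ with extremum (λ x y → suc x ≼ suc y) tr (λ x y → total (suc x) (suc y)) (p ∘ suc) i′ pi′
...     | m , pm , max with true-or-false (p zero) | total (suc m) zero
...       | inj₁ p0 | inj₁ m≼0 = zero , p0 , λ where
            zero    _ → total-refl total zero
            (suc j) e → tr (max j e) m≼0
...       | inj₁ p0 | inj₂ 0≼m = suc m , pm , λ where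
            zero    _ → 0≼m
            (suc j) e → max j e
...       | inj₂ p0 | _ = suc m , pm , λ where
            zero    e → absurd e p0
            (suc j) e → max j e

-- Cardinality of finite sets

card-mono : ∀ {n} {A B : BSet n} → A ⊆ᵇ B → card A ≤ card B
card-mono {zero}  h = z≤n
card-mono {suc n} {A} {B} h with A zero in a | B zero in b
... | true  | true  = s≤s (card-mono (h ∘ suc))
... | true  | false = absurd (h zero a) b
... | false | true  = m≤n⇒m≤1+n (card-mono (h ∘ suc))
... | false | false = card-mono (h ∘ suc)

card-mono-< : ∀ {n} {A B : BSet n} → A ⊆ᵇ B → ∀ i → i ∉ᵇ A → i ∈ᵇ B → card A < card B
card-mono-< {suc n} {A} {B} h zero a b with A zero | B zero
card-mono-< {suc n} {A} {B} h zero refl refl | _ | _ = s≤s (card-mono (h ∘ suc))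
card-mono-< {suc n} {A} {B} h (suc i) a b with A zero in a₀ | B zero in b₀
... | true  | true  = s≤s (card-mono-< (h ∘ suc) i a b)
... | true  | false = absurd (h zero a₀) b₀
... | false | true  = m≤n⇒m≤1+n (card-mono-< (h ∘ suc) i a b)
... | false | false = card-mono-< (h ∘ suc) i a b

full : ∀ {n} → BSet n
full _ = true

card-full : ∀ n → card (full {n}) ≡ n
card-full zero    = refl
card-full (suc n) = cong suc (card-full n)

card-∅ : ∀ n → card {n} (λ _ → false) ≡ 0
card-∅ zero    = refl
card-∅ (suc n) = card-∅ n

card≤n : ∀ {n} (A : BSet n) → card A ≤ n
card≤n A = ≤-trans (card-mono {A = A} {B = full} λ _ _ → refl) (≤-reflexive (card-full _))

card-empty : ∀ {n} {A : BSet n} → card A ≡ 0 → ∀ i → i ∉ᵇ A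
card-empty {suc n} {A} e i with A zero in a
card-empty {suc n} {A} () i       | true
card-empty {suc n} {A} e  zero    | false = a
card-empty {suc n} {A} e  (suc i) | false = card-empty e i

card-∪ : ∀ {n} {A B C : BSet n} → (∀ i → i ∈ᵇ C → i ∈ᵇ A ⊎ i ∈ᵇ B) → card C ≤ card A + card B
card-∪ {zero}  h = z≤n
card-∪ {suc n} {A} {B} {C} h with A zero in a | B zero in b | C zero in c
... | true  | true  | true  = s≤s (≤-trans (card-∪ (h ∘ suc)) (≤-trans (m≤n⇒m≤1+n ≤-refl) (≤-reflexive (sym (+-suc _ _)))))
... | true  | false | true  = s≤s (card-∪ (h ∘ suc))
... | false | true  | true  = ≤-trans (s≤s (card-∪ (h ∘ suc))) (≤-reflexive (sym (+-suc _ _)))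
... | true  | true  | false = m≤n⇒m≤1+n (≤-trans (card-∪ (h ∘ suc)) (≤-trans (m≤n⇒m≤1+n ≤-refl) (≤-reflexive (sym (+-suc _ _)))))
... | true  | false | false = m≤n⇒m≤1+n (card-∪ (h ∘ suc))
... | false | true  | false = ≤-trans (m≤n⇒m≤1+n (card-∪ (h ∘ suc))) (≤-reflexive (sym (+-suc _ _)))
... | false | false | false = card-∪ (h ∘ suc)
... | false | false | true with h zero c
...   | inj₁ e = absurd e a
...   | inj₂ e = absurd e b

card-⊎ : ∀ {n} {A B C : BSet n} → A ⊆ᵇ C → B ⊆ᵇ C → (∀ i → i ∈ᵇ A → i ∉ᵇ B) → card A + card B ≤ card C
card-⊎ {zero}  hA hB d = z≤n
card-⊎ {suc n} {A} {B} {C} hA hB d with A zero in a | B zero in b | C zero in c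
... | true  | true  | _     = absurd b (d zero a)
... | true  | false | false = absurd (hA zero a) c
... | false | true  | false = absurd (hB zero b) c
... | true  | false | true  = s≤s (card-⊎ (hA ∘ suc) (hB ∘ suc) (d ∘ suc))
... | false | true  | true  = ≤-trans (≤-reflexive (+-suc _ _)) (s≤s (card-⊎ (hA ∘ suc) (hB ∘ suc) (d ∘ suc)))
... | false | false | true  = m≤n⇒m≤1+n (card-⊎ (hA ∘ suc) (hB ∘ suc) (d ∘ suc))
... | false | false | false = card-⊎ (hA ∘ suc) (hB ∘ suc) (d ∘ suc)

-- The substitute for a while loop: a round either decreases `μ` or leaves it at zero, so that late
-- rounds may idle, and as many rounds as the initial measure suffice.
fold-exhaust : ∀ {k} {A : Set} (P : A → Set) (μ : A → ℕ) (f : Fin k → A → A) →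
  (∀ i a → P a → P (f i a) × (μ (f i a) < μ a ⊎ μ (f i a) ≡ 0)) →
  ∀ {a} → P a → μ a ≤ k → P (fold f a) × μ (fold f a) ≡ 0
fold-exhaust {zero}  P μ f step p le = p , n≤0⇒n≡0 le
fold-exhaust {suc k} P μ f step {a} p le with step (fromℕ k) a p
... | p′ , d = fold-exhaust P μ (f ∘ inject₁) (step ∘ inject₁) p′
  ([ (λ lt → s≤s⁻¹ (≤-trans lt le)) , (λ e → ≤-trans (≤-reflexive e) z≤n) ]′ d)

module _ {n : ℕ} where

  infixr 6 _∩_ _∖_
  infixr 5 _∪_

  _∩_ _∪_ _∖_ : BSet n → BSet n → BSet n
  (A ∩ B) i = A i && B i
  (A ∪ B) i = A i || B i
  (A ∖ B) i = A i && neg (B i)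

  ⁅_⁆ : Fin n → BSet n
  ⁅ v ⁆ i = v == i

  ∈-∉-≢ : ∀ {A : BSet n} {i j} → i ∈ᵇ A → j ∉ᵇ A → i ≢ j
  ∈-∉-≢ i∈A j∉A refl = absurd i∈A j∉A

  ∈⁅⁆ : ∀ v → v ∈ᵇ ⁅ v ⁆
  ∈⁅⁆ = ==-refl

  ∈∪⁅⁆-elim : ∀ A v {i} → i ∈ᵇ (A ∪ ⁅ v ⁆) → i ∈ᵇ A ⊎ i ≡ v
  ∈∪⁅⁆-elim A v {i} e with ||-elim {A i} e
  ... | inj₁ h = inj₁ h
  ... | inj₂ h = inj₂ (sym (==⇒≡ h))

  ∈∖⁅⁆-intro : ∀ {A v i} → i ∈ᵇ A → i ≢ v → i ∈ᵇ (A ∖ ⁅ v ⁆)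
  ∈∖⁅⁆-intro {v = v} e ne = &&-intro e (neg-intro (≢⇒==-false (ne ∘ sym)))

  ∈∖⁅⁆-elim : ∀ {A v i} → i ∈ᵇ (A ∖ ⁅ v ⁆) → i ∈ᵇ A × i ≢ v
  ∈∖⁅⁆-elim {A} {v} {i} e with &&-elim {A i} e
  ... | a , b = a , λ { refl → absurd (==-refl v) (neg-elim b) }

  card-remove : ∀ {A u} → u ∈ᵇ A → card (A ∖ ⁅ u ⁆) < card A
  card-remove {A} {u} u∈A = card-mono-< (λ i e → proj₁ (∈∖⁅⁆-elim {A} {u} e)) u
    (not-true λ e → proj₂ (∈∖⁅⁆-elim {A} {u} e) refl) u∈A

-- Minimum cuts of hypergraphs.  P a x says that the vertex a lies on the
-- hyperedge x.

  Matrix : Set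
  Matrix = Fin n → BSet n

  -- Hyperedges are named by vertices of the graph, so the set of cut hyperedges is itself a
  -- candidate cutset, and its cardinality is the weight of the cut.
  cut : Matrix → BSet n → BSet n → BSet n
  cut P A Y x = some (λ a → A a && (Y a && P a x)) && some (λ a → A a && (neg (Y a) && P a x))

  Side : Matrix → BSet n → BSet n → Bool → Fin n → Set
  Side P A Y b x = ∃[ a ] (a ∈ᵇ A × Y a ≡ b × P a x ≡ true)

  cut-intro : ∀ {P A Y x} → (∀ b → Side P A Y b x) → x ∈ᵇ cut P A Y
  cut-intro h with h true | h false
  ... | a , a∈A , ya , pa | b , b∈A , yb , pb =
    &&-intro (some-intro a (&&-intro a∈A (&&-intro ya pa)))
             (some-intro b (&&-intro b∈A (&&-intro (neg-intro yb) pb)))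

  cut-elim : ∀ {P A Y x} → x ∈ᵇ cut P A Y → ∀ b → Side P A Y b x
  cut-elim {P} {A} {Y} {x} e b with &&-elim {some (λ a → A a && (Y a && P a x))} e
  cut-elim e true | h , _ with some-elim h
  ... | a , h′ with &&-elim h′
  ...   | a∈A , h″ with &&-elim h″
  ...     | ya , pa = a , a∈A , ya , pa
  cut-elim e false | _ , h with some-elim h
  ... | a , h′ with &&-elim h′
  ...   | a∈A , h″ with &&-elim h″
  ...     | ya , pa = a , a∈A , neg-elim ya , pa

  cut-intro₂ : ∀ {P A Y x u v} → u ∈ᵇ A → v ∈ᵇ A → Y u ≢ Y v → P u x ≡ true → P v x ≡ true →
               x ∈ᵇ cut P A Y
  cut-intro₂ {P} {A} {Y} {x} {u} {v} u∈A v∈A ne pu pv = cut-intro {P} {A} {Y} (side _ _ refl refl)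
    where
    side : ∀ y z → Y u ≡ y → Y v ≡ z → ∀ b → Side P A Y b x
    side true  true  eu ev b = ⊥-elim (ne (trans eu (sym ev)))
    side false false eu ev b = ⊥-elim (ne (trans eu (sym ev)))
    side true  false eu ev true  = u , u∈A , eu , pu
    side true  false eu ev false = v , v∈A , ev , pv
    side false true  eu ev true  = v , v∈A , ev , pv
    side false true  eu ev false = u , u∈A , eu , pu

  cut-mono : ∀ {P A B Y} → A ⊆ᵇ B → cut P A Y ⊆ᵇ cut P B Y
  cut-mono {P} {A} {B} {Y} h x e = cut-intro {P} {B} {Y} λ b →
    let a , a∈A , ya , pa = cut-elim {P} {A} {Y} e b in a , h a a∈A , ya , pa

  -- The single vertex `v` cannot lie on both sides, so one of the two witnesses lies in `A`.
  cut-touches : ∀ {P A Y v x} → x ∈ᵇ cut P (A ∪ ⁅ v ⁆) Y → ∃[ a ] (a ∈ᵇ A × P a x ≡ true)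
  cut-touches {P} {A} {Y} {v} e with cut-elim {P} {A ∪ ⁅ v ⁆} {Y} e true | cut-elim {P} {A ∪ ⁅ v ⁆} {Y} e false
  ... | a , a∈ , ya , pa | b , b∈ , yb , pb with ∈∪⁅⁆-elim A v a∈ | ∈∪⁅⁆-elim A v b∈
  ...   | inj₁ a∈A  | _         = a , a∈A , pa
  ...   | inj₂ refl | inj₁ b∈A  = b , b∈A , pb
  ...   | inj₂ refl | inj₂ refl = absurd ya yb

  Splits : BSet n → BSet n → Set
  Splits A Y = ∀ b → ∃[ a ] (a ∈ᵇ A × Y a ≡ b)

  -- A hyperedge outside I may not be cut: sets with such hyperedges count as
  -- full, which is at least as large as any set.
  norm : BSet n → BSet n → BSet n
  norm I D = if every (λ x → neg (D x) || I x) then D else full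

  norm-cases : ∀ I D → (D ⊆ᵇ I × norm I D ≡ D) ⊎ norm I D ≡ full
  norm-cases I D with every (λ x → neg (D x) || I x) in e
  ... | false = inj₂ refl
  ... | true  = inj₁ ((λ i d → [ (λ h → absurd d (neg-elim h)) , id ]′ (||-elim {neg (D i)} (every-elim e i))) , refl)

  norm-⊆ : ∀ {I D} → D ⊆ᵇ I → norm I D ≡ D
  norm-⊆ {I} {D} h with every (λ x → neg (D x) || I x) | every-intro {p = λ x → neg (D x) || I x} entry
    where
    entry : ∀ x → neg (D x) || I x ≡ true
    entry x with D x in d
    ... | true  = h x d
    ... | false = refl
  ... | _ | refl = refl

  -- In `(A , Q , t , u , D)`, `A` holds the vertices ordered so far, `Q` the hyperedges that they
  -- touch, `t` and `u` are the last two vertices, and `D` is the normed set of hyperedges that `u`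
  -- shares with its predecessors.
  Order : Set
  Order = BSet n × BSet n × Fin n × Fin n × BSet n

  State : Set
  State = BSet n × Matrix × BSet n

  maximal : BSet n → BSet n → Matrix → BSet n → BSet n → BSet n
  maximal I alive P A Q v = (alive ∖ A) v &&
    every (λ w → neg ((alive ∖ A) w) || (card (norm I (Q ∩ P w)) ≤ᵇ card (norm I (Q ∩ P v))))

  extend : BSet n → BSet n → Matrix → Order → Order
  extend I alive P (A , Q , t , u , D) =
    pick (maximal I alive P A Q) (λ v → A ∪ ⁅ v ⁆ , Q ∪ P v , u , v , norm I (Q ∩ P v)) (A , Q , t , u , D)

  order : BSet n → BSet n → Matrix → Fin n → Order
  order I alive P a = fold {n} (λ _ → extend I alive P) (⁅ a ⁆ , P a , a , a , full)

  -- Hyperedges keep their names under contraction, so cuts before and after it are compared as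
  -- sets. The row of `u` stays, but `u` is no longer alive.
  merge : Matrix → Fin n → Fin n → Matrix
  merge P t u r x = P r x || (t == r && P u x)

  smaller : BSet n → BSet n → BSet n
  smaller A B = if card A ≤ᵇ card B then A else B

  contract : Order → State → State
  contract (A , Q , t , u , D) (alive , P , best) =
    alive ∖ ⁅ u ⁆ , merge P t u , smaller best D

  phase : BSet n → State → State
  phase I (alive , P , best) =
    pick alive (λ a → contract (order I alive P a) (alive , P , best)) (alive , P , best)

  improve : BSet n → Matrix → BSet n → BSet n
  improve I M best = proj₂ (proj₂ (fold {n} (λ _ → phase I) ((λ i → neg (I i)) , M , best)))

  smaller-≤ˡ : ∀ A B → card (smaller A B) ≤ card A
  smaller-≤ˡ A B with card A ≤ᵇ card B in e
  ... | true  = ≤-refl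
  ... | false = ≰⇒≥ λ le → absurd (≤⇒≤ᵇ-true le) e

  smaller-≤ʳ : ∀ A B → card (smaller A B) ≤ card B
  smaller-≤ʳ A B with card A ≤ᵇ card B in e
  ... | true  = ≤ᵇ-true⇒≤ e
  ... | false = ≤-refl

  smaller-either : ∀ (V : BSet n → Set) A B → V A → V B → V (smaller A B)
  smaller-either V A B a b with card A ≤ᵇ card B
  ... | true  = a
  ... | false = b

  -- Maximum adjacency orderings

  module Ordering (I alive : BSet n) (P : Matrix) (w₀ : Fin n) (w₀∉I : w₀ ∉ᵇ I) where

    Finite : BSet n → Set
    Finite Y = cut P alive Y ⊆ᵇ I

    weight : BSet n → ℕ
    weight D = card (norm I D)

    -- As `w₀` lies outside `I`, `full` is strictly larger than `B`; a weight of at most `card B`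
    -- therefore rules out a forbidden hyperedge in `D`.
    norm-small : ∀ {D B} → B ⊆ᵇ I → weight D ≤ card B → D ⊆ᵇ I × norm I D ≡ D
    norm-small {D} {B} B⊆I le with norm-cases I D
    ... | inj₁ h = h
    ... | inj₂ e = ⊥-elim (<⇒≱ (card-mono-< {A = B} {B = full} (λ _ _ → refl) w₀
                                  (not-true λ h → absurd (B⊆I w₀ h) w₀∉I) refl)
                               (≤-trans (≤-reflexive (cong card (sym e))) le))

    data Last (A : BSet n) (t u : Fin n) (D : BSet n) : Set where
      start : (∀ i → i ∈ᵇ A → i ≡ u) → D ≡ full → Last A t u D
      later : ∀ D₀ → t ∈ᵇ A → t ≢ u → D ≡ norm I D₀ →
              (∀ x → x ∈ᵇ D₀ → P u x ≡ true × ∃[ a ] (a ∈ᵇ A × a ≢ u × P a x ≡ true)) →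
              (∀ a x → P u x ≡ true → a ∈ᵇ A → a ≢ u → P a x ≡ true → x ∈ᵇ D₀) →
              (∀ Y → Finite Y → Y t ≢ Y u → card D ≤ card (cut P A Y)) → Last A t u D

    -- `frontier` is the induction statement of Stoer and Wagner, here for every unordered `v` that
    -- `Y` separates from the last vertex `u`, rather than for the next vertex alone. Applied to the
    -- vertex that is appended next, it becomes the bound on `D` stored in `later`.
    record Ordered (s : Order) : Set where
      A = proj₁ s
      Q = proj₁ (proj₂ s)
      t = proj₁ (proj₂ (proj₂ s))
      u = proj₁ (proj₂ (proj₂ (proj₂ s)))
      D = proj₂ (proj₂ (proj₂ (proj₂ s)))
      field
        A⊆alive  : A ⊆ᵇ alive
        u∈A      : u ∈ᵇ A
        Q-sound  : ∀ x → x ∈ᵇ Q → ∃[ a ] (a ∈ᵇ A × P a x ≡ true)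
        Q-compl  : ∀ a x → a ∈ᵇ A → P a x ≡ true → x ∈ᵇ Q
        frontier : ∀ Y → Finite Y → ∀ v → v ∈ᵇ alive → v ∉ᵇ A → Y v ≢ Y u →
                   weight (Q ∩ P v) ≤ card (cut P (A ∪ ⁅ v ⁆) Y)
        last     : Last A t u D

    start-ordered : ∀ a → a ∈ᵇ alive → Ordered (⁅ a ⁆ , P a , a , a , full)
    start-ordered a a∈ = record
      { A⊆alive  = λ i e → subst (_∈ᵇ alive) (==⇒≡ e) a∈
      ; u∈A      = ∈⁅⁆ a
      ; Q-sound  = λ x e → a , ∈⁅⁆ a , e
      ; Q-compl  = λ b x e p → subst (λ c → P c x ≡ true) (sym (==⇒≡ e)) p
      ; frontier = frontier
      ; last     = start (λ i e → sym (==⇒≡ e)) refl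
      }
      where
      frontier : ∀ Y → Finite Y → ∀ v → v ∈ᵇ alive → v ∉ᵇ ⁅ a ⁆ → Y v ≢ Y a →
                 weight (P a ∩ P v) ≤ card (cut P (⁅ a ⁆ ∪ ⁅ v ⁆) Y)
      frontier Y fin v v∈ _ ne = ≤-trans
        (≤-reflexive (cong card (norm-⊆ {I} {P a ∩ P v} λ x e →
          let pa , pv = &&-elim {P a x} e in fin x (cut-intro₂ {P} {alive} {Y} v∈ a∈ ne pv pa))))
        (card-mono λ x e →
          let pa , pv = &&-elim {P a x} e in
          cut-intro₂ {P} {⁅ a ⁆ ∪ ⁅ v ⁆} {Y} {x} {v} {a}
            (||-introʳ {a == v} (∈⁅⁆ v)) (||-introˡ (∈⁅⁆ a)) ne pv pa)

    module _ {A Q : BSet n} {t u : Fin n} {D : BSet n} (ord : Ordered (A , Q , t , u , D)) where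

      open Ordered ord hiding (A; Q; t; u; D)

      private
        -- The hyperedges that w shares with v but not with A are cut and new.
        grow : ∀ {Y v w B} → Finite Y → v ∈ᵇ alive → w ∈ᵇ alive → Y w ≢ Y v →
               B ⊆ᵇ I → B ⊆ᵇ cut P ((A ∪ ⁅ v ⁆) ∪ ⁅ w ⁆) Y → (∀ x → x ∈ᵇ B → x ∈ᵇ Q) →
               weight (Q ∩ P w) ≤ card B →
               weight ((Q ∪ P v) ∩ P w) ≤ card (cut P ((A ∪ ⁅ v ⁆) ∪ ⁅ w ⁆) Y)
        grow {Y} {v} {w} {B} fin v∈ w∈ ne B⊆I B⊆cut B⊆Q le with norm-small {Q ∩ P w} B⊆I le
        ... | L⊆I , L≡ = ≤-trans (≤-reflexive (cong card (norm-⊆ {I} L′⊆I)))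
          (≤-trans (card-∪ {A = Q ∩ P w} {B = E} split)
            (≤-trans (+-monoˡ-≤ (card E) (≤-trans (≤-reflexive (cong card (sym L≡))) le))
              (card-⊎ {A = B} {B = E} B⊆cut E⊆cut disjoint)))
          where
          L′ E : BSet n
          L′ = (Q ∪ P v) ∩ P w
          E  = (P v ∩ P w) ∖ Q
          E-elim : ∀ x → x ∈ᵇ E → P v x ≡ true × P w x ≡ true × x ∉ᵇ Q
          E-elim x e with &&-elim {(P v ∩ P w) x} e
          ... | vw , q = let pv , pw = &&-elim {P v x} vw in pv , pw , neg-elim q
          split : ∀ x → x ∈ᵇ L′ → x ∈ᵇ (Q ∩ P w) ⊎ x ∈ᵇ E
          split x e with &&-elim {(Q ∪ P v) x} e | true-or-false (Q x)
          ... | _   , pw | inj₁ q = inj₁ (&&-intro q pw)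
          ... | qpv , pw | inj₂ q with ||-elim {Q x} qpv
          ...   | inj₁ q′ = absurd q′ q
          ...   | inj₂ pv = inj₂ (&&-intro (&&-intro pv pw) (neg-intro q))
          E⊆ : ∀ {S} → v ∈ᵇ S → w ∈ᵇ S → E ⊆ᵇ cut P S Y
          E⊆ {S} v∈S w∈S x e = let pv , pw , _ = E-elim x e in
            cut-intro₂ {P} {S} {Y} w∈S v∈S ne pw pv
          E⊆cut : E ⊆ᵇ cut P ((A ∪ ⁅ v ⁆) ∪ ⁅ w ⁆) Y
          E⊆cut = E⊆ {(A ∪ ⁅ v ⁆) ∪ ⁅ w ⁆} (||-introˡ (||-introʳ {A v} (∈⁅⁆ v))) (||-introʳ {(A ∪ ⁅ v ⁆) w} (∈⁅⁆ w))
          L′⊆I : L′ ⊆ᵇ I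
          L′⊆I x e = [ L⊆I x , (λ h → fin x (E⊆ {alive} v∈ w∈ x h)) ]′ (split x e)
          disjoint : ∀ x → x ∈ᵇ B → x ∉ᵇ E
          disjoint x b = not-true λ e → absurd (B⊆Q x b) (proj₂ (proj₂ (E-elim x e)))

        touched : ∀ {Y v} x → x ∈ᵇ cut P (A ∪ ⁅ v ⁆) Y → x ∈ᵇ Q
        touched {Y} {v} x e = let a , a∈ , pa = cut-touches {P} {A} {Y} {v} e in Q-compl a x a∈ pa

      extend-ordered : ∀ v → maximal I alive P A Q v ≡ true →
                       Ordered (A ∪ ⁅ v ⁆ , Q ∪ P v , u , v , norm I (Q ∩ P v))
      extend-ordered v e with &&-elim {(alive ∖ A) v} e
      ... | v∈∖ , max′ with &&-elim {alive v} v∈∖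
      ...   | v∈ , v∉A′ = record
        { A⊆alive  = A′⊆alive
        ; u∈A      = ||-introʳ {A v} (∈⁅⁆ v)
        ; Q-sound  = λ x q → [ (λ h → let a , a∈ , pa = Q-sound x h in a , ||-introˡ a∈ , pa)
                             , (λ h → v , ||-introʳ {A v} (∈⁅⁆ v) , h) ]′ (||-elim {Q x} q)
        ; Q-compl  = λ a x a∈ pa → [ (λ h → ||-introˡ (Q-compl a x h pa))
                                   , (λ { refl → ||-introʳ {Q x} pa }) ]′ (∈∪⁅⁆-elim A v a∈)
        ; frontier = frontier′
        ; last     = later (Q ∩ P v) (||-introˡ u∈A) u≢v refl
            (λ x q → let q′ , pv = &&-elim {Q x} q ; a , a∈ , pa = Q-sound x q′ in
                     pv , a , ||-introˡ a∈ , ∈-∉-≢ {A = A} a∈ v∉A , pa)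
            (λ a x pv a∈ a≢v pa → &&-intro
              ([ (λ h → Q-compl a x h pa) , (λ h → ⊥-elim (a≢v h)) ]′ (∈∪⁅⁆-elim A v a∈)) pv)
            (λ Y fin ne → frontier Y fin v v∈ v∉A (ne ∘ sym))
        }
        where
        v∉A : v ∉ᵇ A
        v∉A = neg-elim v∉A′
        u≢v : u ≢ v
        u≢v = ∈-∉-≢ {A = A} u∈A v∉A
        A′⊆alive : (A ∪ ⁅ v ⁆) ⊆ᵇ alive
        A′⊆alive i e = [ A⊆alive i , (λ { refl → v∈ }) ]′ (∈∪⁅⁆-elim A v e)
        max : ∀ w → w ∈ᵇ alive → w ∉ᵇ A → weight (Q ∩ P w) ≤ weight (Q ∩ P v)
        max w w∈ w∉ with ||-elim {neg ((alive ∖ A) w)} (every-elim max′ w)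
        ... | inj₁ h = absurd (&&-intro w∈ (neg-intro w∉)) (neg-elim h)
        ... | inj₂ h = ≤ᵇ-true⇒≤ h
        frontier′ : ∀ Y → Finite Y → ∀ w → w ∈ᵇ alive → w ∉ᵇ (A ∪ ⁅ v ⁆) → Y w ≢ Y v →
                    weight ((Q ∪ P v) ∩ P w) ≤ card (cut P ((A ∪ ⁅ v ⁆) ∪ ⁅ w ⁆) Y)
        -- If `Y` keeps `u` and `v` together, then `w` was already opposite to `u` and its old bound
        -- applies. Otherwise `v` was, and the choice of `v` as maximal bounds the weight of `w` by
        -- that of `v`. In both cases `grow` adds the hyperedges that `v` and `w` share outside `Q`.
        frontier′ Y fin w w∈ w∉A′ ne with Y v Bool.≟ Y u
        ... | yes eq = grow {Y} {v} {w} {cut P (A ∪ ⁅ w ⁆) Y} fin v∈ w∈ ne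
              (λ x h → fin x (cut-mono {P} {A ∪ ⁅ w ⁆} {alive} {Y} (λ i e → [ A⊆alive i , (λ { refl → w∈ }) ]′ (∈∪⁅⁆-elim A w e)) x h))
              (cut-mono {P} {A ∪ ⁅ w ⁆} {(A ∪ ⁅ v ⁆) ∪ ⁅ w ⁆} {Y} λ i e →
                [ (λ h → ||-introˡ (||-introˡ h)) , (λ { refl → ||-introʳ {(A ∪ ⁅ v ⁆) i} (∈⁅⁆ i) }) ]′ (∈∪⁅⁆-elim A w e))
              (touched {Y} {w})
              (frontier Y fin w w∈ w∉A (λ e → ne (trans e (sym eq))))
          where
          w∉A : w ∉ᵇ A
          w∉A = not-true λ h → absurd (||-introˡ h) w∉A′
        ... | no neq = grow {Y} {v} {w} {cut P (A ∪ ⁅ v ⁆) Y} fin v∈ w∈ ne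
              (λ x h → fin x (cut-mono {P} {A ∪ ⁅ v ⁆} {alive} {Y} A′⊆alive x h))
              (cut-mono {P} {A ∪ ⁅ v ⁆} {(A ∪ ⁅ v ⁆) ∪ ⁅ w ⁆} {Y} λ i e → ||-introˡ e)
              (touched {Y} {v})
              (≤-trans (max w w∈ w∉A) (frontier Y fin v v∈ v∉A neq))
          where
          w∉A : w ∉ᵇ A
          w∉A = not-true λ h → absurd (||-introˡ h) w∉A′

      maximal-exists : ∀ v → v ∈ᵇ (alive ∖ A) → ∃[ m ] maximal I alive P A Q m ≡ true
      maximal-exists v v∈ with extremum (λ x y → weight (Q ∩ P x) ≤ weight (Q ∩ P y)) ≤-trans
                                 (λ x y → ≤-total (weight (Q ∩ P x)) (weight (Q ∩ P y))) (alive ∖ A) v v∈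
      ... | m , m∈ , max = m , &&-intro m∈ (every-intro entry)
        where
        entry : ∀ w → neg ((alive ∖ A) w) || (weight (Q ∩ P w) ≤ᵇ weight (Q ∩ P m)) ≡ true
        entry w with (alive ∖ A) w in e
        ... | false = refl
        ... | true  = ≤⇒≤ᵇ-true (max w e)

    remaining : Order → ℕ
    remaining (A , _) = card (alive ∖ A)

    extend-step : ∀ s → Ordered s → Ordered (extend I alive P s) ×
                  (remaining (extend I alive P s) < remaining s ⊎ remaining (extend I alive P s) ≡ 0)
    extend-step s@(A , Q , t , u , D) ord
      with extend I alive P s | pick-view (maximal I alive P A Q) (λ v → A ∪ ⁅ v ⁆ , Q ∪ P v , u , v , norm I (Q ∩ P v)) s
    ... | _ | found v e = extend-ordered ord v e , inj₁ (card-mono-<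
            (λ i h → let i∈ , i∉ = &&-elim {alive i} h in
              &&-intro i∈ (neg-intro (not-true λ a → absurd (||-introˡ a) (neg-elim i∉))))
            v (not-true λ h → absurd (||-introʳ {A v} (∈⁅⁆ v)) (neg-elim (proj₂ (&&-elim {alive v} h))))
            (proj₁ (&&-elim {(alive ∖ A) v} e)))
    ... | _ | none h = ord , inj₂ (n≤0⇒n≡0 (≤-trans
            (card-mono {B = λ _ → false} λ i e → let m , em = maximal-exists ord i e in absurd em (h m))
            (≤-reflexive (card-∅ n))))

    order-correct : ∀ a → a ∈ᵇ alive → Ordered (order I alive P a) × alive ⊆ᵇ proj₁ (order I alive P a)
    order-correct a a∈ with fold-exhaust Ordered remaining (λ _ → extend I alive P) (λ _ → extend-step)
                              (start-ordered a a∈) (card≤n (alive ∖ ⁅ a ⁆))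
    ... | ord , done = ord , λ i i∈ → neg-false (not-true λ e → absurd (&&-intro i∈ e) (card-empty done i))

  -- Contraction of the last vertex u of an ordering into its predecessor t

  module _ {alive : BSet n} {P : Matrix} {t u : Fin n}
           (t∈ : t ∈ᵇ alive) (u∈ : u ∈ᵇ alive) (t≢u : t ≢ u) where

    private
      alive′ = alive ∖ ⁅ u ⁆
      P′     = merge P t u

      t∈′ : t ∈ᵇ alive′
      t∈′ = ∈∖⁅⁆-intro {alive} t∈ t≢u

    -- The two sides may differ at `u`, which is dead after the contraction. A bipartition of the
    -- contracted hypergraph thus lifts by giving `u` the side of `t`.
    module _ {Y Y′ : BSet n} (Yu : Y u ≡ Y t) (agree : ∀ i → i ≢ u → Y i ≡ Y′ i) where

      Side-merge⁺ : ∀ {b x} → Side P alive Y b x → Side P′ alive′ Y′ b x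
      Side-merge⁺ {b} {x} (a , a∈ , ya , pa) with a ≟ u
      ... | yes refl = t , t∈′ , trans (sym (agree t t≢u)) (trans (sym Yu) ya) ,
                       ||-introʳ {P t x} (&&-intro (==-refl t) pa)
      ... | no  a≢u  = a , ∈∖⁅⁆-intro {alive} a∈ a≢u , trans (sym (agree a a≢u)) ya , ||-introˡ pa

      Side-merge⁻ : ∀ {b x} → Side P′ alive′ Y′ b x → Side P alive Y b x
      Side-merge⁻ {b} {x} (a , a∈′ , ya , pa) with ∈∖⁅⁆-elim {alive} {u} a∈′ | ||-elim {P a x} pa
      ... | a∈ , a≢u | inj₁ pa′ = a , a∈ , trans (agree a a≢u) ya , pa′
      ... | a∈ , a≢u | inj₂ h with &&-elim {t == a} h
      ...   | e , pu with ==⇒≡ {i = t} {a} e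
      ...     | refl = u , u∈ , trans Yu (trans (agree a a≢u) ya) , pu

      cut-merge⁺ : cut P alive Y ⊆ᵇ cut P′ alive′ Y′
      cut-merge⁺ x e = cut-intro {P′} {alive′} {Y′} λ b → Side-merge⁺ (cut-elim {P} {alive} {Y} e b)

      cut-merge⁻ : cut P′ alive′ Y′ ⊆ᵇ cut P alive Y
      cut-merge⁻ x e = cut-intro {P} {alive} {Y} λ b → Side-merge⁻ (cut-elim {P′} {alive′} {Y′} e b)

    Splits-merge : ∀ {Y} → Y t ≡ Y u → Splits alive Y → Splits alive′ Y
    Splits-merge e h b with h b
    ... | a , a∈ , ya with a ≟ u
    ...   | yes refl = t , t∈′ , trans e ya
    ...   | no  a≢u  = a , ∈∖⁅⁆-intro {alive} a∈ a≢u , ya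

  -- Correctness of the minimum cut algorithm

  module Improvement (I : BSet n) (M : Matrix)
    (Valid Target : BSet n → Set) (valid-full : Valid full)
    -- The two inclusions express that `S` is the cut; an equality of functions would ask for
    -- extensionality.
    (sound : ∀ Y → Splits (λ i → neg (I i)) Y → ∀ S → S ⊆ᵇ I →
             S ⊆ᵇ cut M (λ i → neg (I i)) Y → cut M (λ i → neg (I i)) Y ⊆ᵇ S → Valid S)
    (target⊆I : ∀ {S} → Target S → S ⊆ᵇ I)
    (complete : ∀ {S} → Target S →
                ∃[ Y ] (Splits (λ i → neg (I i)) Y × cut M (λ i → neg (I i)) Y ⊆ᵇ S)) where

    -- By `covers`, each target is either already matched by `best` or still bounds some cut that
    -- survived all contractions. Once no vertex is alive nothing splits, the second alternative is
    -- void, and `best` is optimal.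
    record Contracted (best₀ : BSet n) (s : State) : Set where
      alive = proj₁ s
      P     = proj₁ (proj₂ s)
      best  = proj₂ (proj₂ s)
      field
        alive∉I  : ∀ i → i ∈ᵇ alive → i ∉ᵇ I
        valid    : Valid best
        improved : card best ≤ card best₀
        lifts    : ∀ Y → Splits alive Y → ∀ S → S ⊆ᵇ I →
                   S ⊆ᵇ cut P alive Y → cut P alive Y ⊆ᵇ S → Valid S
        covers   : ∀ {S} → Target S → card best ≤ card S ⊎
                   ∃[ Y ] (Splits alive Y × cut P alive Y ⊆ᵇ S)

    contract-correct : ∀ {best₀ alive P best A Q t u D} → Contracted best₀ (alive , P , best) →
      (w₀ : Fin n) (w₀∉I : w₀ ∉ᵇ I) → Ordering.Ordered I alive P w₀ w₀∉I (A , Q , t , u , D) →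
      alive ⊆ᵇ A → Contracted best₀ (contract (A , Q , t , u , D) (alive , P , best))
    contract-correct {best₀} {alive} {P} {best} {A} {Q} {t} {u} {D} con w₀ w₀∉I ord alive⊆A =
      by-cases (Ordering.Ordered.last ord)
      where
      open Contracted con hiding (alive; P; best)
      open Ordering.Ordered ord using (A⊆alive; u∈A)

      alive′ : BSet n
      alive′ = alive ∖ ⁅ u ⁆

      best′ : BSet n
      best′ = smaller best D

      alive∉I′ : ∀ i → i ∈ᵇ alive′ → i ∉ᵇ I
      alive∉I′ i e = alive∉I i (proj₁ (∈∖⁅⁆-elim {alive} {u} e))

      improved′ : card best′ ≤ card best₀
      improved′ = ≤-trans (smaller-≤ˡ best D) improved

      by-cases : Ordering.Last I alive P w₀ w₀∉I A t u D →
                 Contracted best₀ (alive′ , merge P t u , best′)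
      -- The ordering never left its start vertex: it is the only vertex alive, no cut remains, and
      -- `full` is a harmless candidate.
      by-cases (Ordering.start single refl) = record
        { alive∉I  = alive∉I′
        ; valid    = smaller-either Valid best full valid valid-full
        ; improved = improved′
        ; lifts    = λ Y sp → let a , a∈ , _ = sp true in ⊥-elim (empty a a∈)
        ; covers   = λ T → [ (λ le → inj₁ (≤-trans (smaller-≤ˡ best D) le)) , impossible ]′ (covers T)
        }
        where
        is-u : ∀ i → i ∈ᵇ alive → i ≡ u
        is-u i i∈ = single i (alive⊆A i i∈)
        empty : ∀ i → ¬ i ∈ᵇ alive′
        empty i e = let i∈ , i≢u = ∈∖⁅⁆-elim {alive} {u} e in i≢u (is-u i i∈)
        impossible : ∀ {Z : BSet n → Set} {C : Set} → ∃[ Y ] (Splits alive Y × Z Y) → C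
        impossible (Y , sp , _) with sp true | sp false
        ... | a , a∈ , ya | b , b∈ , yb with is-u a a∈ | is-u b b∈
        ...   | refl | refl = absurd ya yb
      by-cases (Ordering.later D₀ t∈A t≢u refl D₀-sound D₀-compl bound) = record
        { alive∉I  = alive∉I′
        ; valid    = smaller-either Valid best D valid valid-D
        ; improved = improved′
        ; lifts    = lifts′
        ; covers   = λ T → [ (λ le → inj₁ (≤-trans (smaller-≤ˡ best D) le)) , covers′ T ]′ (covers T)
        }
        where
        t∈ : t ∈ᵇ alive
        t∈ = A⊆alive t t∈A
        u∈ : u ∈ᵇ alive
        u∈ = A⊆alive u u∈A

        isolate : Splits alive ⁅ u ⁆
        isolate true  = u , u∈ , ∈⁅⁆ u
        isolate false = t , t∈ , ≢⇒==-false (t≢u ∘ sym)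

        valid-D : Valid (norm I D₀)
        valid-D with norm-cases I D₀
        ... | inj₂ e = subst Valid (sym e) valid-full
        ... | inj₁ (D₀⊆I , e) = subst Valid (sym e) (lifts ⁅ u ⁆ isolate D₀ D₀⊆I ⇒ ⇐)
          where
          ⇒ : D₀ ⊆ᵇ cut P alive ⁅ u ⁆
          ⇒ x e = let pu , a , a∈ , a≢u , pa = D₀-sound x e in cut-intro {P} {alive} {⁅ u ⁆} λ where
            true  → u , u∈ , ∈⁅⁆ u , pu
            false → a , A⊆alive a a∈ , ≢⇒==-false (a≢u ∘ sym) , pa
          ⇐ : cut P alive ⁅ u ⁆ ⊆ᵇ D₀
          ⇐ x e with cut-elim {P} {alive} {⁅ u ⁆} e true | cut-elim {P} {alive} {⁅ u ⁆} e false
          ... | v , _ , ev , pv | a , a∈ , ea , pa with ==⇒≡ {i = u} {v} ev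
          ...   | refl = D₀-compl a x pv (alive⊆A a a∈) (λ { refl → absurd (==-refl a) ea }) pa

        lifts′ : ∀ Y′ → Splits alive′ Y′ → ∀ S → S ⊆ᵇ I → S ⊆ᵇ cut (merge P t u) alive′ Y′ →
                 cut (merge P t u) alive′ Y′ ⊆ᵇ S → Valid S
        lifts′ Y′ sp S S⊆I ⇒ ⇐ = lifts Y splits S S⊆I
          (λ x e → cut-merge⁻ {alive} {P} t∈ u∈ t≢u {Y} {Y′} Yu agree x (⇒ x e))
          (λ x e → ⇐ x (cut-merge⁺ {alive} {P} t∈ u∈ t≢u {Y} {Y′} Yu agree x e))
          where
          Y : BSet n
          Y i = if i == u then Y′ t else Y′ i
          agree : ∀ i → i ≢ u → Y i ≡ Y′ i
          agree i i≢u = cong (λ b → if b then Y′ t else Y′ i) (≢⇒==-false i≢u)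
          Yu : Y u ≡ Y t
          Yu = trans (cong (λ b → if b then Y′ t else Y′ u) (==-refl u)) (sym (agree t t≢u))
          splits : Splits alive Y
          splits b = let a , a∈′ , ya = sp b ; a∈ , a≢u = ∈∖⁅⁆-elim {alive} {u} a∈′ in
            a , a∈ , trans (agree a a≢u) ya

        covers′ : ∀ {S} → Target S → ∃[ Y ] (Splits alive Y × cut P alive Y ⊆ᵇ S) →
                  card best′ ≤ card S ⊎ ∃[ Y ] (Splits alive′ Y × cut (merge P t u) alive′ Y ⊆ᵇ S)
        -- A cut that keeps `t` and `u` together survives the contraction. One that separates them
        -- is no smaller than `D`; `bound` applies since the cut lies in a target, hence in `I`, and
        -- so uses no forbidden hyperedge.
        covers′ T (Y , sp , cut⊆) with Y t Bool.≟ Y u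
        ... | yes e = inj₂ (Y , Splits-merge {alive} {P} t∈ u∈ t≢u e sp ,
                            λ x h → cut⊆ x (cut-merge⁻ {alive} {P} t∈ u∈ t≢u {Y} {Y} (sym e) (λ _ _ → refl) x h))
        ... | no ne = inj₁ (≤-trans (smaller-≤ʳ best D) (≤-trans
                (bound Y (λ x h → target⊆I T x (cut⊆ x h)) ne)
                (card-mono λ x h → cut⊆ x (cut-mono {P} {A} {alive} {Y} A⊆alive x h))))

    phase-step : ∀ {best₀} s → Contracted best₀ s → Contracted best₀ (phase I s) ×
                 (card (proj₁ (phase I s)) < card (proj₁ s) ⊎ card (proj₁ (phase I s)) ≡ 0)
    phase-step s@(alive , P , best) con
      with phase I s | pick-view alive (λ a → contract (order I alive P a) s) s
    ... | _ | found a a∈ =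
      let a∉I = Contracted.alive∉I con a a∈
          ord , all = Ordering.order-correct I alive P a a∉I a a∈
          open Ordering.Ordered ord using (A⊆alive; u∈A)
      in contract-correct con a a∉I ord all , inj₁ (card-remove {alive} (A⊆alive _ u∈A))
    ... | _ | none h = con , inj₂ (n≤0⇒n≡0 (≤-trans
            (card-mono {B = λ _ → false} λ i e → absurd e (h i)) (≤-reflexive (card-∅ n))))

    improve-correct : ∀ {best₀} → Valid best₀ →
      Valid (improve I M best₀) × card (improve I M best₀) ≤ card best₀ ×
      (∀ {S} → Target S → card (improve I M best₀) ≤ card S)
    improve-correct {best₀} v₀ with fold-exhaust {n} (Contracted best₀) (λ s → card (proj₁ s)) (λ _ → phase I)
      (λ _ → phase-step) {(λ i → neg (I i)) , M , best₀} start (card≤n (λ i → neg (I i)))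
      where
      start : Contracted best₀ ((λ i → neg (I i)) , M , best₀)
      start = record
        { alive∉I = λ i → neg-elim ; valid = v₀ ; improved = ≤-refl
        ; lifts = sound ; covers = λ T → inj₂ (complete T) }
    ... | con , done = valid , improved , λ T → [ id , impossible ]′ (covers T)
      where
      open Contracted con
      impossible : ∀ {Z : BSet n → Set} {C : Set} → ∃[ Y ] (Splits alive Y × Z Y) → C
      impossible (Y , sp , _) = let a , a∈ , _ = sp true in absurd a∈ (card-empty done a)

-- The integer cube root of 3 ^ r

-- Equality holds at 3, and from there on one step multiplies the cube by at most 64/27, less than
-- 3. The summand in `m` is the difference of 3 s³ and (s + 1)³ at s = 3 + m.
cube≤3^ : ∀ s → s ^ 3 ≤ 3 ^ s
cube≤3^ 0 = z≤n
cube≤3^ 1 = m≤m+n 1 2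
cube≤3^ 2 = m≤m+n 8 1
cube≤3^ 3 = ≤-refl
cube≤3^ (suc s@(suc (suc (suc m)))) = begin
  suc s ^ 3                               ≤⟨ m≤m+n (suc s ^ 3) _ ⟩
  suc s ^ 3 + (17 + 33 * m + 15 * (m * m) + 2 * (m * m * m))  ≡⟨ eqn m ⟨
  3 * s ^ 3                               ≤⟨ *-monoʳ-≤ 3 (cube≤3^ s) ⟩
  3 ^ suc s                               ∎
  where
  open ≤-Reasoning
  eqn : ∀ m → 3 * ((3 + m) * ((3 + m) * ((3 + m) * 1))) ≡
              (4 + m) * ((4 + m) * ((4 + m) * 1)) + (17 + 33 * m + 15 * (m * m) + 2 * (m * m * m))
  eqn = solve-∀

greatestRoot : ℕ → ℕ → ℕ
greatestRoot x zero    = 0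
greatestRoot x (suc k) with suc k ^ 3 ≤? x
... | yes _ = suc k
... | no  _ = greatestRoot x k

greatestRoot-cube : ∀ x k → greatestRoot x k ^ 3 ≤ x
greatestRoot-cube x zero    = z≤n
greatestRoot-cube x (suc k) with suc k ^ 3 ≤? x
... | yes le = le
... | no  _  = greatestRoot-cube x k

greatestRoot-max : ∀ x k y → y ≤ k → y ^ 3 ≤ x → y ≤ greatestRoot x k
greatestRoot-max x zero    y y≤k le = y≤k
greatestRoot-max x (suc k) y y≤k le with suc k ^ 3 ≤? x
... | yes _ = y≤k
... | no gt with m≤n⇒m<n∨m≡n y≤k
...   | inj₁ lt   = greatestRoot-max x k y (s≤s⁻¹ lt) le
...   | inj₂ refl = ⊥-elim (gt le)

root : ℕ → ℕ
-- Searching up to `3 ^ r` misses nothing, as a number is at most its cube.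
root r = greatestRoot (3 ^ r) (3 ^ r)

root-cube : ∀ r → root r ^ 3 ≤ 3 ^ r
root-cube r = greatestRoot-cube (3 ^ r) (3 ^ r)

n≤n^3 : ∀ n → n ≤ n ^ 3
n≤n^3 zero    = z≤n
n≤n^3 (suc n) = m≤m*n (suc n) (suc n ^ 2)

root-max : ∀ r {y} → y ^ 3 ≤ 3 ^ r → y ≤ root r
root-max r {y} le = greatestRoot-max (3 ^ r) (3 ^ r) y (≤-trans (n≤n^3 y) le) le

1≤root : ∀ r → 1 ≤ root r
1≤root r = root-max r (^-monoʳ-≤ 3 {0} {r} z≤n)

-- The recurrence for leaves: s children, each with at most r undecided vertices. After cubing it is
-- `cube≤3^`.
root-branch : ∀ s r → s * root r ≤ root (s + r)
root-branch s r = root-max (s + r) (begin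
  (s * root r) ^ 3     ≡⟨ eqn s (root r) ⟩
  s ^ 3 * root r ^ 3   ≤⟨ *-mono-≤ (cube≤3^ s) (root-cube r) ⟩
  3 ^ s * 3 ^ r        ≡⟨ ^-distribˡ-+-* 3 s r ⟨
  3 ^ (s + r)          ∎)
  where
  open ≤-Reasoning
  eqn : ∀ a b → (a * b) * ((a * b) * ((a * b) * 1)) ≡ a * (a * (a * 1)) * (b * (b * (b * 1)))
  eqn = solve-∀

nodes : ℕ → ℕ
nodes r = 3 * (r + 1) * root r

1≤nodes : ∀ r → 1 ≤ nodes r
1≤nodes r = *-mono-≤ {1} {3 * (r + 1)} (*-mono-≤ {1} {3} {1} (s≤s z≤n) (m≤n+m 1 r)) (1≤root r)

-- A branching over `suc s` vertices is a chain of `suc s` binary nodes, each with one child, closed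
-- by a leaf. The extra 1 and `suc s` are each at most `G`, while `nodes` gains at least `3 * G`
-- from the growth of its linear factor.
nodes-branch : ∀ s q → 1 + suc s * (1 + nodes q) ≤ nodes (suc s + q)
nodes-branch s q = begin
  1 + suc s * (1 + nodes q)                         ≡⟨ eqn₁ s q (root q) ⟩
  1 + (suc s + 3 * (q + 1) * (suc s * root q))      ≤⟨ +-mono-≤ (1≤root (suc s + q)) (+-mono-≤ s≤G (*-monoʳ-≤ (3 * (q + 1)) (root-branch (suc s) q))) ⟩
  G + (G + 3 * (q + 1) * G)                         ≤⟨ m≤m+n _ (G + 3 * s * G) ⟩
  G + (G + 3 * (q + 1) * G) + (G + 3 * s * G)       ≡⟨ eqn₂ s q G ⟩
  nodes (suc s + q)                                 ∎
  where
  open ≤-Reasoning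
  G = root (suc s + q)
  s≤G : suc s ≤ G
  s≤G = ≤-trans (≤-trans (≤-reflexive (sym (*-identityʳ (suc s)))) (*-monoʳ-≤ (suc s) (1≤root q))) (root-branch (suc s) q)
  eqn₁ : ∀ s q g → 1 + suc s * (1 + 3 * (q + 1) * g) ≡ 1 + (suc s + 3 * (q + 1) * (suc s * g))
  eqn₁ = solve-∀
  eqn₂ : ∀ s q g → g + (g + 3 * (q + 1) * g) + (g + 3 * s * g) ≡ 3 * (suc s + q + 1) * g
  eqn₂ = solve-∀

-- Enumeration of independent sets

module _ {n : ℕ} where

  -- In `(R , I , C)`, `R` is undecided, `I` is chosen, and `C` holds the vertices that the current
  -- branching has still to try.
  BState : Set
  BState = BSet n × BSet n × BSet n

  minimal : Matrix → BSet n → BSet n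
  minimal M R v = R v && every (λ w → neg (R w) || (card (M v ∩ R) ≤ᵇ card (M w ∩ R)))

  fresh : Matrix → BSet n → BSet n
  fresh M R = pick (minimal M R) (λ v → M v ∩ R) (λ _ → false)

  branch : Matrix → BSet n → BSet n → Fin n → BState
  branch M R I u = R ∖ M u , I ∪ ⁅ u ⁆ , fresh M (R ∖ M u)

  -- An empty `C` ends the run both when `R` is exhausted and when a chain of siblings is finished.
  -- In the second case `I` may fail to be maximal, but it is independent, and improving with it
  -- does no harm.
  step : Matrix → BSet n → BState → Bool × BSet n × BState × BState
  step M best (R , I , C) =
    pick C (λ u → false , best , branch M R I u , (R , I , C ∖ ⁅ u ⁆))
           (true , improve I M best , (R , I , C) , (R , I , C))

  step-cases : ∀ M best R I C →
    (∃[ u ] (u ∈ᵇ C × step M best (R , I , C) ≡ (false , best , branch M R I u , (R , I , C ∖ ⁅ u ⁆)))) ⊎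
    ((∀ i → i ∉ᵇ C) × step M best (R , I , C) ≡ (true , improve I M best , (R , I , C) , (R , I , C)))
  step-cases M best R I C
    with step M best (R , I , C)
       | pick-view {A = Bool × BSet n × BState × BState} C (λ u → false , best , branch M R I u , (R , I , C ∖ ⁅ u ⁆))
                     (true , improve I M best , (R , I , C) , (R , I , C))
  ... | _ | found u e = inj₁ (u , e , refl)
  ... | _ | none h    = inj₂ (h , refl)

  -- Correctness of the enumeration

  module Enumeration (M : Matrix {n}) (M-refl : ∀ v → M v v ≡ true) (M-sym : ∀ {u v} → M u v ≡ true → M v u ≡ true)
    (Valid Goal : BSet n → Set) where

    Stable : BSet n → Set
    Stable J = ∀ a b → a ∈ᵇ J → b ∈ᵇ J → M a b ≡ true → a ≡ b

    Improves : BSet n → Set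
    Improves I = ∀ {best} → Valid best → Valid (improve I M best) × card (improve I M best) ≤ card best ×
                 (∀ {J} → Goal J → J ⊆ᵇ I → card (improve I M best) ≤ card J)

    fresh-cases : ∀ R →
      ((∀ i → i ∉ᵇ R) × (∀ i → i ∉ᵇ fresh M R)) ⊎
      ∃[ v ] (v ∈ᵇ R × (∀ w → w ∈ᵇ R → card (M v ∩ R) ≤ card (M w ∩ R)) × fresh M R ≡ M v ∩ R)
    fresh-cases R with fresh M R | pick-view (minimal M R) (λ v → M v ∩ R) (λ _ → false)
    ... | _ | found v e = let v∈ , min = &&-elim {R v} e in inj₂ (v , v∈ , (λ w w∈ →
            [ (λ h → absurd w∈ (neg-elim h)) , ≤ᵇ-true⇒≤ ]′ (||-elim {neg (R w)} (every-elim min w))) , refl)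
    ... | _ | none h = inj₁ ((λ i → not-true (empty i)) , λ _ → refl)
      where
      empty : ∀ i → ¬ i ∈ᵇ R
      empty i i∈ with extremum (λ x y → card (M y ∩ R) ≤ card (M x ∩ R)) (λ p q → ≤-trans q p)
                        (λ x y → ≤-total (card (M y ∩ R)) (card (M x ∩ R))) R i i∈
      ... | m , m∈ , min = absurd (&&-intro m∈ (every-intro entry)) (h m)
        where
        entry : ∀ w → neg (R w) || (card (M m ∩ R) ≤ᵇ card (M w ∩ R)) ≡ true
        entry w with R w in e
        ... | false = refl
        ... | true  = ≤⇒≤ᵇ-true (min w e)

    record Invariant (R I : BSet n) : Set where
      field
        stable : Stable I
        apart  : ∀ i r → i ∈ᵇ I → r ∈ᵇ R → M i r ≡ false

    -- c is a vertex on which branching loses nothing of J.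
    Covered : BSet n → BSet n → BSet n → BSet n → Set
    Covered R I C J = (∀ j → j ∈ᵇ J → j ∈ᵇ I ⊎ j ∈ᵇ R) ×
      ((∀ j → j ∈ᵇ J → j ∈ᵇ I) ⊎
       ∃[ c ] (c ∈ᵇ C × (∀ j → j ∈ᵇ J → j ∈ᵇ R → M c j ≡ true → j ≡ c)))

    Outcome : BSet n → BSet n → BSet n → BSet n → ℕ → Set
    Outcome R I C best b = ∃[ best′ ] ∃[ k ] (Run (step M) best (R , I , C) best′ k × k ≤ b ×
      Valid best′ × card best′ ≤ card best ×
      (∀ {J} → Goal J → Stable J → Covered R I C J → card best′ ≤ card J))

    fresh⊆ : ∀ R → fresh M R ⊆ᵇ R
    fresh⊆ R i i∈ with fresh-cases R
    ... | inj₁ (_ , h)         = absurd i∈ (h i)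
    ... | inj₂ (v , _ , _ , e) = proj₂ (&&-elim {M v i} (trans (sym (cong (λ A → A i) e)) i∈))

    fresh-covers : ∀ {R I J} → Stable J → (∀ j → j ∈ᵇ J → j ∈ᵇ I ⊎ j ∈ᵇ R) → Covered R I (fresh M R) J
    fresh-covers {R} {I} {J} st J⊆ with fresh-cases R
    ... | inj₁ (h , _) = J⊆ , inj₁ λ j j∈ → [ id , (λ r → absurd r (h j)) ]′ (J⊆ j j∈)
    ... | inj₂ (v , v∈ , _ , e) with true-or-false (some (J ∩ (M v ∩ R)))
    ...   | inj₁ h with some-elim {p = J ∩ (M v ∩ R)} h
    ...     | c , h′ with &&-elim {J c} h′
    ...       | c∈J , c∈C = J⊆ , inj₂ (c , trans (cong (λ A → A c) e) c∈C ,
                  λ j j∈ _ m → sym (st c j c∈J j∈ m))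
    -- Here `v` enters `I` without lying in `J`; a leaf asks only for `J ⊆ᵇ I`, so this loses
    -- nothing.
    fresh-covers {R} {I} {J} st J⊆ | inj₂ (v , v∈ , _ , e) | inj₂ h =
      J⊆ , inj₂ (v , trans (cong (λ A → A v) e) (&&-intro (M-refl v) v∈) ,
        λ j j∈ r m → absurd (some-intro {p = J ∩ (M v ∩ R)} j (&&-intro j∈ (&&-intro m r))) h)

    module _ (improves : ∀ I → Stable I → Improves I) where

      branch-invariant : ∀ {R I u} → Invariant R I → u ∈ᵇ R → Invariant (R ∖ M u) (I ∪ ⁅ u ⁆)
      branch-invariant {R} {I} {u} inv u∈ = record { stable = stable′ ; apart = apart′ }
        where
        open Invariant inv
        stable′ : Stable (I ∪ ⁅ u ⁆)
        stable′ a b a∈ b∈ m with ∈∪⁅⁆-elim I u a∈ | ∈∪⁅⁆-elim I u b∈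
        ... | inj₁ a∈I  | inj₁ b∈I  = stable a b a∈I b∈I m
        ... | inj₁ a∈I  | inj₂ refl = absurd m (apart a u a∈I u∈)
        ... | inj₂ refl | inj₁ b∈I  = absurd (M-sym m) (apart b u b∈I u∈)
        ... | inj₂ refl | inj₂ refl = refl
        apart′ : ∀ i r → i ∈ᵇ (I ∪ ⁅ u ⁆) → r ∈ᵇ (R ∖ M u) → M i r ≡ false
        apart′ i r i∈ r∈ with ∈∪⁅⁆-elim I u i∈ | &&-elim {R r} r∈
        ... | inj₁ i∈I  | r∈R , _ = apart i r i∈I r∈R
        ... | inj₂ refl | _ , h   = neg-elim h

      branch-covers : ∀ {R I u J} → Stable J → (∀ j → j ∈ᵇ J → j ∈ᵇ I ⊎ j ∈ᵇ R) →
                      (∀ j → j ∈ᵇ J → j ∈ᵇ R → M u j ≡ true → j ≡ u) →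
                      Covered (R ∖ M u) (I ∪ ⁅ u ⁆) (fresh M (R ∖ M u)) J
      branch-covers {R} {I} {u} {J} st J⊆ good = fresh-covers {R ∖ M u} {I ∪ ⁅ u ⁆} st cov
        where
        cov : ∀ j → j ∈ᵇ J → j ∈ᵇ (I ∪ ⁅ u ⁆) ⊎ j ∈ᵇ (R ∖ M u)
        cov j j∈ with J⊆ j j∈
        ... | inj₁ i = inj₁ (||-introˡ i)
        ... | inj₂ r with true-or-false (M u j)
        ...   | inj₂ m = inj₂ (&&-intro r (neg-intro m))
        ...   | inj₁ m with good j j∈ r m
        ...     | refl = inj₁ (||-introʳ {I u} (∈⁅⁆ u))

      explore-∅ : ∀ {R I C} best → Invariant R I → (∀ i → i ∉ᵇ C) → Valid best → Outcome R I C best 1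
      explore-∅ {R} {I} {C} best inv empty valid with step-cases M best R I C
      ... | inj₁ (u , u∈ , _) = absurd u∈ (empty u)
      ... | inj₂ (_ , e) =
        let v , le , better = improves I (Invariant.stable inv) valid in
        _ , 1 , leaf e , ≤-refl , v , le , λ goal _ → λ
          { (_ , inj₁ J⊆I)          → better goal J⊆I
          ; (_ , inj₂ (c , c∈ , _)) → absurd c∈ (empty c) }

      -- Runs along the siblings: `R` and `I` stay fixed while `C` shrinks and `best` is passed on.
      -- `sub` is the induction hypothesis for the children.
      explore : ∀ {q} →
        (∀ R I best → Invariant R I → card R ≤ q → Valid best → Outcome R I (fresh M R) best (nodes q)) →
        ∀ m {R I C} best → Invariant R I → C ⊆ᵇ R → (∀ u → u ∈ᵇ R → card (R ∖ M u) ≤ q) →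
        card C ≤ m → Valid best → Outcome R I C best (1 + m * (1 + nodes q))
      explore {q} sub m {R} {I} {C} best inv C⊆R small C≤m valid with step-cases M best R I C
      explore {q} sub m {R} {I} {C} best inv C⊆R small C≤m valid | inj₂ (empty , _) =
        let best′ , k , run , k≤ , rest = explore-∅ best inv empty valid
        in best′ , k , run , ≤-trans k≤ (m≤m+n 1 _) , rest
      explore {q} sub zero    {R} {I} {C} best inv C⊆R small C≤m valid | inj₁ (u , u∈ , e) =
        absurd u∈ (card-empty (n≤0⇒n≡0 C≤m) u)
      explore {q} sub (suc m) {R} {I} {C} best inv C⊆R small C≤m valid | inj₁ (u , u∈ , e)
        with sub (R ∖ M u) (I ∪ ⁅ u ⁆) best (branch-invariant inv (C⊆R u u∈)) (small u (C⊆R u u∈)) valid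
      ... | best₁ , k₁ , run₁ , k₁≤ , valid₁ , le₁ , better₁
        with explore sub m {R} {I} {C ∖ ⁅ u ⁆} best₁ inv (λ i i∈ → C⊆R i (proj₁ (&&-elim {C i} i∈))) small
               (s≤s⁻¹ (≤-trans (card-remove {A = C} u∈) C≤m)) valid₁
      ... | best₂ , k₂ , run₂ , k₂≤ , valid₂ , le₂ , better₂ =
        best₂ , _ , node e run₁ run₂ , bound , valid₂ , ≤-trans le₂ le₁ , better
        where
        eqn : ∀ m b → 1 + b + (1 + m * (1 + b)) ≡ 1 + suc m * (1 + b)
        eqn = solve-∀
        bound : 1 + k₁ + k₂ ≤ 1 + suc m * (1 + nodes q)
        bound = ≤-trans (+-mono-≤ (s≤s k₁≤) k₂≤) (≤-reflexive (eqn m (nodes q)))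
        better : ∀ {J} → Goal J → Stable J → Covered R I C J → card best₂ ≤ card J
        better goal st (J⊆ , inj₁ J⊆I) = better₂ goal st (J⊆ , inj₁ J⊆I)
        better goal st (J⊆ , inj₂ (c , c∈ , good)) with c ≟ u
        ... | yes refl = ≤-trans le₂ (better₁ goal st (branch-covers {R} {I} st J⊆ good))
        ... | no  c≢u  = better₂ goal st (J⊆ , inj₂ (c , ∈∖⁅⁆-intro {A = C} c∈ c≢u , good))

      -- `f` makes the recursion structural, since the size bound `r` drops by a variable amount,
      -- namely the cardinality of `M v ∩ R`. That amount is positive because `v` itself belongs to
      -- the set.
      enumerate : ∀ f r → r ≤ f → ∀ R I best → Invariant R I → card R ≤ r → Valid best →
                  Outcome R I (fresh M R) best (nodes r)
      enumerate f r r≤f R I best inv R≤r valid with fresh-cases R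
      enumerate f r r≤f R I best inv R≤r valid | inj₁ (_ , empty) =
        let best′ , k , run , k≤ , rest = explore-∅ best inv empty valid
        in best′ , k , run , ≤-trans k≤ (1≤nodes r) , rest
      enumerate zero    r r≤f R I best inv R≤r valid | inj₂ (v , v∈ , _) =
        absurd v∈ (card-empty (n≤0⇒n≡0 (≤-trans R≤r r≤f)) v)
      enumerate (suc f) r r≤f R I best inv R≤r valid | inj₂ (v , v∈ , min , e) with card (M v ∩ R) in s≡
      ... | zero  = absurd (&&-intro (M-refl v) v∈) (card-empty s≡ v)
      ... | suc s =
        let best′ , k , run , k≤ , rest = explore
              (λ R I best → enumerate f q (≤-trans (∸-monoˡ-≤ (suc s) r≤f) (m∸n≤m f s)) R I best)
              (suc s) best inv (fresh⊆ R) small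
              (≤-reflexive (trans (cong card e) s≡)) valid
        in best′ , k , run ,
           ≤-trans k≤ (≤-trans (nodes-branch s q) (≤-reflexive (cong nodes (m+[n∸m]≡n s≤r)))) , rest
        where
        q = r ∸ suc s
        s≤r : suc s ≤ r
        s≤r = ≤-trans (≤-trans (≤-reflexive (sym s≡)) (card-mono λ i i∈ → proj₂ (&&-elim {M v i} i∈))) R≤r
        small : ∀ u → u ∈ᵇ R → card (R ∖ M u) ≤ q
        -- `R` is the disjoint union of what survives and `M u ∩ R`, and the latter has at least
        -- `suc s` elements because `v` has minimum degree.
        small u u∈ = m+n≤o⇒m≤o∸n _ (≤-trans (+-monoʳ-≤ (card (R ∖ M u)) (min u u∈))
          (≤-trans (card-⊎ {A = R ∖ M u} {B = M u ∩ R}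
            (λ i i∈ → proj₁ (&&-elim {R i} i∈)) (λ i i∈ → proj₂ (&&-elim {M u i} i∈))
            (λ i i∈ → not-true λ h → absurd (proj₁ (&&-elim {M u i} h)) (neg-elim (proj₂ (&&-elim {R i} i∈))))) R≤r))

-- The algorithm in the object language

pattern v0 = var here
pattern v1 = var (there here)
pattern v2 = var (there (there here))
pattern v3 = var (there (there (there here)))
pattern v4 = var (there (there (there (there here))))
pattern v5 = var (there (there (there (there (there here)))))
pattern v6 = var (there (there (there (there (there (there here))))))

set mat ord state bstate : Ty
set    = vec bool
mat    = vec set
ord    = set ⊗ set ⊗ idx ⊗ idx ⊗ set
state  = set ⊗ mat ⊗ set
bstate = set ⊗ set ⊗ set

module _ {Γ : Ctx} where

  notᵗ : Term Γ bool → Term Γ bool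
  notᵗ a = condᵗ a falseᵗ trueᵗ

  andᵗ orᵗ : Term Γ bool → Term Γ bool → Term Γ bool
  andᵗ a b = condᵗ a b falseᵗ
  orᵗ  a b = condᵗ a trueᵗ b

  -- Tabulating `p` and `f` beforehand keeps the accumulator of the loop out of their context, so no
  -- weakening of terms is involved.
  pickᵗ : ∀ {τ} → Term (idx ∷ Γ) bool → Term (idx ∷ Γ) τ → Term Γ τ → Term Γ τ
  pickᵗ {τ} p f d = appᵗ {Δ = set ∷ vec τ ∷ τ ∷ []} (loopᵗ (condᵗ (atᵗ v2 v0) (atᵗ v3 v0) v1) v2) (tabᵗ p ∷ tabᵗ f ∷ d ∷ [])

module _ {Γ : Ctx} where

  emptyᵗ fullᵗ : Term Γ set
  emptyᵗ = tabᵗ falseᵗ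
  fullᵗ  = tabᵗ trueᵗ

  ∩ᵗ ∪ᵗ ∖ᵗ : Term Γ set → Term Γ set → Term Γ set
  ∩ᵗ a b = appᵗ {Δ = set ∷ set ∷ []} (tabᵗ (andᵗ (atᵗ v1 v0) (atᵗ v2 v0))) (a ∷ b ∷ [])
  ∪ᵗ a b = appᵗ {Δ = set ∷ set ∷ []} (tabᵗ (orᵗ (atᵗ v1 v0) (atᵗ v2 v0))) (a ∷ b ∷ [])
  ∖ᵗ a b = appᵗ {Δ = set ∷ set ∷ []} (tabᵗ (andᵗ (atᵗ v1 v0) (notᵗ (atᵗ v2 v0)))) (a ∷ b ∷ [])

  singletonᵗ : Term Γ idx → Term Γ set
  singletonᵗ u = appᵗ {Δ = idx ∷ []} (tabᵗ (eqᵗ v1 v0)) (u ∷ [])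

everyᵗ : ∀ {Γ} → Term (idx ∷ Γ) bool → Term Γ bool
everyᵗ p = notᵗ (pickᵗ (notᵗ p) trueᵗ falseᵗ)

normᵗ : Term (set ∷ set ∷ []) set
normᵗ = condᵗ (everyᵗ (orᵗ (notᵗ (atᵗ v2 v0)) (atᵗ v1 v0))) v1 fullᵗ

maximalᵗ : Term (set ∷ set ∷ mat ∷ set ∷ set ∷ []) set
maximalᵗ = tabᵗ (andᵗ (atᵗ (∖ᵗ v2 v4) v0)
  (everyᵗ (orᵗ (notᵗ (atᵗ (∖ᵗ v3 v5) v0))
    (leᵗ (appᵗ normᵗ (v2 ∷ ∩ᵗ v6 (atᵗ v4 v0) ∷ [])) (appᵗ normᵗ (v2 ∷ ∩ᵗ v6 (atᵗ v4 v1) ∷ []))))))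

extendᵗ : Term (set ∷ set ∷ mat ∷ ord ∷ []) ord
extendᵗ = appᵗ {Δ = set ∷ set ∷ mat ∷ set ∷ set ∷ idx ∷ ord ∷ []}
  (pickᵗ (atᵗ (appᵗ maximalᵗ (v1 ∷ v2 ∷ v3 ∷ v4 ∷ v5 ∷ [])) v0)
    (pairᵗ (∪ᵗ v4 (singletonᵗ v0)) (pairᵗ (∪ᵗ v5 (atᵗ v3 v0)) (pairᵗ v6 (pairᵗ v0
      (appᵗ normᵗ (v1 ∷ ∩ᵗ v5 (atᵗ v3 v0) ∷ []))))))
    v6)
  (v0 ∷ v1 ∷ v2 ∷ fstᵗ v3 ∷ fstᵗ (sndᵗ v3) ∷ fstᵗ (sndᵗ (sndᵗ (sndᵗ v3))) ∷ v3 ∷ [])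

orderᵗ : Term (set ∷ set ∷ mat ∷ idx ∷ []) ord
orderᵗ = loopᵗ (appᵗ extendᵗ (v2 ∷ v3 ∷ v4 ∷ v1 ∷ []))
  (pairᵗ (singletonᵗ v3) (pairᵗ (atᵗ v2 v3) (pairᵗ v3 (pairᵗ v3 fullᵗ))))

contractᵗ : Term (ord ∷ set ∷ mat ∷ set ∷ []) state
contractᵗ = appᵗ {Δ = idx ∷ idx ∷ set ∷ set ∷ mat ∷ set ∷ []}
  (pairᵗ (∖ᵗ v3 (singletonᵗ v1)) (pairᵗ
    (tabᵗ (tabᵗ (orᵗ (atᵗ (atᵗ v6 v1) v0) (andᵗ (eqᵗ v2 v1) (atᵗ (atᵗ v6 v3) v0)))))
    (condᵗ (leᵗ v5 v2) v5 v2)))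
  (fstᵗ (sndᵗ (sndᵗ v0)) ∷ fstᵗ (sndᵗ (sndᵗ (sndᵗ v0))) ∷ sndᵗ (sndᵗ (sndᵗ (sndᵗ v0))) ∷ v1 ∷ v2 ∷ v3 ∷ [])

phaseᵗ : Term (set ∷ state ∷ []) state
phaseᵗ = appᵗ {Δ = set ∷ set ∷ mat ∷ set ∷ []}
  (pickᵗ (atᵗ v2 v0)
    (appᵗ contractᵗ (appᵗ orderᵗ (v1 ∷ v2 ∷ v3 ∷ v0 ∷ []) ∷ v2 ∷ v3 ∷ v4 ∷ []))
    (pairᵗ v1 (pairᵗ v2 v3)))
  (v0 ∷ fstᵗ v1 ∷ fstᵗ (sndᵗ v1) ∷ sndᵗ (sndᵗ v1) ∷ [])

improveᵗ : Term (set ∷ mat ∷ set ∷ []) set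
improveᵗ = sndᵗ (sndᵗ (loopᵗ (appᵗ phaseᵗ (v2 ∷ v1 ∷ [])) (pairᵗ (tabᵗ (notᵗ (atᵗ v1 v0))) (pairᵗ v1 v2))))

freshᵗ : Term (mat ∷ set ∷ []) set
freshᵗ = pickᵗ
  (andᵗ (atᵗ v2 v0) (everyᵗ (orᵗ (notᵗ (atᵗ v3 v0)) (leᵗ (∩ᵗ (atᵗ v2 v1) v3) (∩ᵗ (atᵗ v2 v0) v3)))))
  (∩ᵗ (atᵗ v1 v0) v2) emptyᵗ

branchᵗ : Term (mat ∷ set ∷ set ∷ idx ∷ []) bstate
branchᵗ = appᵗ {Δ = set ∷ mat ∷ set ∷ idx ∷ []}
  (pairᵗ v0 (pairᵗ (∪ᵗ v2 (singletonᵗ v3)) (appᵗ freshᵗ (v1 ∷ v0 ∷ []))))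
  (∖ᵗ v1 (atᵗ v0 v3) ∷ v0 ∷ v2 ∷ v3 ∷ [])

stepᵗ : Term (set ∷ bstate ∷ mat ∷ []) (bool ⊗ set ⊗ bstate ⊗ bstate)
stepᵗ = appᵗ {Δ = set ∷ set ∷ set ∷ set ∷ mat ∷ bstate ∷ []}
  (pickᵗ (atᵗ v4 v0)
    (pairᵗ falseᵗ (pairᵗ v1 (pairᵗ
      (appᵗ branchᵗ (v5 ∷ v2 ∷ v3 ∷ v0 ∷ []))
      (pairᵗ v2 (pairᵗ v3 (∖ᵗ v4 (singletonᵗ v0)))))))
    -- Arguments are evaluated eagerly, so the minimum cut is computed at every node and not only at
    -- leaves; the excess is covered by the polynomial cost of a step.
    (pairᵗ trueᵗ (pairᵗ (appᵗ improveᵗ (v2 ∷ v4 ∷ v0 ∷ [])) (pairᵗ v5 v5))))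
  (v0 ∷ fstᵗ v1 ∷ fstᵗ (sndᵗ v1) ∷ sndᵗ (sndᵗ v1) ∷ v2 ∷ v1 ∷ [])

closureᵗ : Term (mat ∷ []) mat
closureᵗ = tabᵗ (tabᵗ (orᵗ (eqᵗ v1 v0) (atᵗ (atᵗ v2 v1) v0)))

initᵗ : Args (mat ∷ []) (set ∷ bstate ∷ mat ∷ [])
initᵗ = fullᵗ ∷ pairᵗ fullᵗ (pairᵗ emptyᵗ (appᵗ freshᵗ (closureᵗ ∷ fullᵗ ∷ []))) ∷ closureᵗ ∷ []

closure : ∀ {n} → (Fin n → Fin n → Bool) → Matrix {n}
closure E u v = u == v || E u v

-- Growth of the running time

coeff degree : Poly → ℕ
coeff (constant c) = c
coeff X        = 1
coeff (p :+ q) = coeff p + coeff q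
coeff (p :* q) = coeff p * coeff q
degree (constant c) = 0
degree X        = 1
-- The sum of the degrees stands in for their maximum; it dominates both powers because the base is
-- positive.
degree (p :+ q) = degree p + degree q
degree (p :* q) = degree p + degree q

eval-bound : ∀ p m → eval p (suc m) ≤ coeff p * suc m ^ degree p
eval-bound (constant c)  m = ≤-reflexive (sym (*-identityʳ c))
eval-bound X        m = ≤-reflexive (eqn (suc m))
  where
  eqn : ∀ n → n ≡ 1 * (n * 1)
  eqn = solve-∀
eval-bound (p :+ q) m = begin
  eval p n + eval q n                                    ≤⟨ +-mono-≤ (eval-bound p m) (eval-bound q m) ⟩
  coeff p * n ^ degree p + coeff q * n ^ degree q
    ≤⟨ +-mono-≤ (*-monoʳ-≤ (coeff p) (^-monoʳ-≤ n (m≤m+n (degree p) (degree q))))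
                (*-monoʳ-≤ (coeff q) (^-monoʳ-≤ n (m≤n+m (degree q) (degree p)))) ⟩
  coeff p * n ^ d + coeff q * n ^ d                      ≡⟨ *-distribʳ-+ (n ^ d) (coeff p) (coeff q) ⟨
  (coeff p + coeff q) * n ^ d                            ∎
  where
  open ≤-Reasoning
  n = suc m
  d = degree p + degree q
eval-bound (p :* q) m = begin
  eval p n * eval q n                                    ≤⟨ *-mono-≤ (eval-bound p m) (eval-bound q m) ⟩
  coeff p * n ^ degree p * (coeff q * n ^ degree q)      ≡⟨ eqn (coeff p) (coeff q) (n ^ degree p) (n ^ degree q) ⟩
  coeff p * coeff q * (n ^ degree p * n ^ degree q)      ≡⟨ cong (coeff p * coeff q *_) (^-distribˡ-+-* n (degree p) (degree q)) ⟨
  coeff p * coeff q * n ^ (degree p + degree q)          ∎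
  where
  open ≤-Reasoning
  n = suc m
  eqn : ∀ a b c d → a * c * (b * d) ≡ a * b * (c * d)
  eqn = solve-∀

time : Poly → Poly → ℕ → ℕ
time p q n = eval p n + nodes n * eval q n

-- Both summands of `time` are at most a polynomial times `root n`, and cubing turns `root n` into
-- at most `3 ^ n`. The threshold 1 excludes n = 0, where powers of n are not monotone in the
-- exponent.
time-O* : ∀ p q → time p q ∈O*[ 3 ^n/ 3 ]
time-O* p q = coeff r , degree r , 1 , bound
  where
  r : Poly
  r = p :+ constant 3 :* (X :+ constant 1) :* q
  eqn₁ : ∀ a g b → a * g + 3 * (b * g) ≡ (a + 3 * b) * g
  eqn₁ = solve-∀
  eqn₂ : ∀ n g b → 3 * (n + 1) * g * b ≡ 3 * (n + 1) * b * g
  eqn₂ = solve-∀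
  eqn₃ : ∀ a b → (a * b) * ((a * b) * ((a * b) * 1)) ≡ a * (a * (a * 1)) * (b * (b * (b * 1)))
  eqn₃ = solve-∀
  open ≤-Reasoning
  time≤ : ∀ n → time p q n ≤ eval r n * root n
  time≤ n = begin
    eval p n + nodes n * eval q n
      ≤⟨ +-mono-≤ (≤-trans (≤-reflexive (sym (*-identityʳ _))) (*-monoʳ-≤ (eval p n) (1≤root n)))
                  (≤-reflexive (eqn₂ n (root n) (eval q n))) ⟩
    eval p n * root n + 3 * (n + 1) * eval q n * root n   ≡⟨ *-distribʳ-+ (root n) (eval p n) _ ⟨
    eval r n * root n                                     ∎
  bound : ∀ n → 1 ≤ n → time p q n ^ 3 ≤ (coeff r * n ^ degree r) ^ 3 * 3 ^ n
  bound n@(suc m) _ = begin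
    time p q n ^ 3                                ≤⟨ ^-monoˡ-≤ 3 (≤-trans (time≤ n) (*-monoˡ-≤ (root n) (eval-bound r m))) ⟩
    (coeff r * n ^ degree r * root n) ^ 3         ≡⟨ eqn₃ (coeff r * n ^ degree r) (root n) ⟩
    (coeff r * n ^ degree r) ^ 3 * root n ^ 3     ≤⟨ *-monoʳ-≤ ((coeff r * n ^ degree r) ^ 3) (root-cube n) ⟩
    (coeff r * n ^ degree r) ^ 3 * 3 ^ n          ∎

-- Cutsets and bipartitions

-- The double negation shift, valid here because the index set is finite.
¬¬-∀ : ∀ {n} {P : Fin n → Set} → (∀ i → ¬ ¬ P i) → ¬ ¬ (∀ i → P i)
¬¬-∀ {zero}  h k = k λ ()
¬¬-∀ {suc n} h k = h zero λ p → ¬¬-∀ (h ∘ suc) λ q → k λ { zero → p ; (suc i) → q i }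

module _ {n : ℕ} where

  ∈-tabulate⁺ : ∀ {A : BSet n} {i} → i ∈ᵇ A → i ∈ tabulate A
  ∈-tabulate⁺ {A} {i} e = lookup⇒[]= i (tabulate A) (trans (lookup∘tabulate A i) e)

  ∈-tabulate⁻ : ∀ {A : BSet n} {i} → i ∈ tabulate A → i ∈ᵇ A
  ∈-tabulate⁻ {A} {i} e = trans (sym (lookup∘tabulate A i)) ([]=⇒lookup e)

  ∈-∁⁺ : ∀ {A : BSet n} {i} → i ∉ᵇ A → i ∈ ∁ (tabulate A)
  ∈-∁⁺ e = x∉p⇒x∈∁p λ h → absurd (∈-tabulate⁻ h) e

  ∈-∁⁻ : ∀ {A : BSet n} {i} → i ∈ ∁ (tabulate A) → i ∉ᵇ A
  ∈-∁⁻ e = not-true λ h → x∈∁p⇒x∉p e (∈-tabulate⁺ h)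

∣tabulate∣ : ∀ {n} (A : BSet n) → ∣ tabulate A ∣ ≡ card A
∣tabulate∣ {zero}  A = refl
∣tabulate∣ {suc n} A with A zero
... | true  = cong suc (∣tabulate∣ (A ∘ suc))
... | false = ∣tabulate∣ (A ∘ suc)

module _ {n : ℕ} (G : Graph n) where

  -- Positive evidence that deleting `S` disconnects the graph, whereas `Cutset` only refutes
  -- connectedness.
  record Bipartition (S Y : BSet n) : Set where
    field
      left right : Fin n
      left∉S     : left ∉ᵇ S
      right∉S    : right ∉ᵇ S
      left∈Y     : left ∈ᵇ Y
      right∉Y    : right ∉ᵇ Y
      closed     : ∀ a b → a ∉ᵇ S → b ∉ᵇ S → a ∈ᵇ Y → Adjacent G a b → b ∈ᵇ Y

  bipartition⇒cutset : ∀ {S Y} → Bipartition S Y → Cutset G (tabulate S)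
  bipartition⇒cutset {S} {Y} bi connected =
    absurd (stays (connected left right (∈-∁⁺ left∉S) (∈-∁⁺ right∉S)) left∈Y) right∉Y
    where
    open Bipartition bi
    stays : ∀ {a b} → Star (InducedAdjacent G (∁ (tabulate S))) a b → a ∈ᵇ Y → b ∈ᵇ Y
    stays ε                      a∈ = a∈
    stays ((a∉ , b∉ , e) ◅ walk) a∈ = stays walk (closed _ _ (∈-∁⁻ a∉) (∈-∁⁻ b∉) a∈ e)

  -- Under double negation reachability may be taken to be decidable. If `v` were unreachable from
  -- `u`, the set of vertices reachable from `u` would be a bipartition; without bipartitions the
  -- rest is thus connected.
  cutset⇒¬¬bipartition : ∀ {S} → Cutset G (tabulate S) → ¬ ¬ (∃[ Y ] Bipartition S Y)
  cutset⇒¬¬bipartition {S} cutset unsplit =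
    ¬¬-∀ (λ u → ¬¬-∀ (λ v → ¬¬-excluded-middle)) (λ reach? → cutset (connected reach?))
    where
    Walk : Fin n → Fin n → Set
    Walk = Star (InducedAdjacent G (∁ (tabulate S)))
    connected : (∀ u v → Dec (Walk u v)) → InducedConnected G (∁ (tabulate S))
    connected reach? u v u∈ v∈ with reach? u v in e
    ... | yes walk = walk
    ... | no  ¬walk = ⊥-elim (unsplit ((λ w → does (reach? u w)) , record
      { left = u ; right = v ; left∉S = ∈-∁⁻ u∈ ; right∉S = ∈-∁⁻ v∈
      ; left∈Y = reached ε ; right∉Y = cong does e
      ; closed = λ a b a∉ b∉ a∈ ab → reached (reached⁻ a∈ ◅◅ (∈-∁⁺ a∉ , ∈-∁⁺ b∉ , ab) ◅ ε) }))
      where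
      reached : ∀ {w} → Walk u w → does (reach? u w) ≡ true
      reached {w} walk with reach? u w
      ... | yes _ = refl
      ... | no h  = ⊥-elim (h walk)
      reached⁻ : ∀ {w} → does (reach? u w) ≡ true → Walk u w
      reached⁻ {w} h with reach? u w
      ... | yes walk = walk

  -- Independent cutsets as hypergraph cuts

  M : Matrix {n}
  M = closure (adj G)

  M-refl : ∀ v → M v v ≡ true
  M-refl v = ||-introˡ (==-refl v)

  M-adj : ∀ {u v} → Adjacent G u v → M u v ≡ true
  M-adj {u} {v} e = ||-introʳ {u == v} e

  M-elim : ∀ {u v} → M u v ≡ true → u ≡ v ⊎ Adjacent G u v
  M-elim {u} {v} e = [ (λ h → inj₁ (==⇒≡ h)) , inj₂ ]′ (||-elim {u == v} e)

  adj-sym : ∀ {u v} → Adjacent G u v → Adjacent G v u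
  adj-sym {u} {v} e = trans (symmetric G v u) e

  M-sym : ∀ {u v} → M u v ≡ true → M v u ≡ true
  M-sym {u} {v} e = [ (λ { refl → M-refl u }) , (λ h → M-adj (adj-sym h)) ]′ (M-elim e)

  -- `full` is the initial value and means that nothing has been found yet; it is never a cutset.
  Goal Valid : BSet n → Set
  Goal S  = IndependentCutset G (tabulate S)
  Valid S = S ≡ full ⊎ Goal S

  open Enumeration M M-refl (λ {u} {v} → M-sym {u} {v}) Valid Goal

  stable⇒¬adj : ∀ {I u v} → Stable I → u ∈ᵇ I → v ∈ᵇ I → ¬ Adjacent G u v
  stable⇒¬adj {I} {u} {v} st u∈ v∈ e with st u v u∈ v∈ (M-adj e)
  ... | refl = absurd e (loopless G u)

  independent⇒stable : ∀ {S} → Independent G (tabulate S) → Stable S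
  independent⇒stable ind a b a∈ b∈ e =
    [ id , (λ h → ⊥-elim (ind a b (∈-tabulate⁺ a∈) (∈-tabulate⁺ b∈) h)) ]′ (M-elim e)

  module _ {I : BSet n} (st : Stable I) where

    private
      W : BSet n
      W i = neg (I i)

    -- The closed neighbourhood of a vertex outside `S` is not cut, so its members outside `I` all
    -- lie on one side. `Y′` passes this side on to the vertices of `I`, which `Y` need not place
    -- correctly.
    hypergraph-cut⇒cutset : ∀ Y → Splits W Y → ∀ S → S ⊆ᵇ I → cut M W Y ⊆ᵇ S → Goal S
    hypergraph-cut⇒cutset Y sp S S⊆I cut⊆S =
      bipartition⇒cutset {S} {Y′} bi , λ u v u∈ v∈ →
        stable⇒¬adj st (S⊆I u (∈-tabulate⁻ u∈)) (S⊆I v (∈-tabulate⁻ v∈))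
      where
      Y′ : BSet n
      Y′ y = some (λ a → W a && (Y a && M a y))

      Y′-intro : ∀ {a y} → a ∈ᵇ W → a ∈ᵇ Y → M a y ≡ true → y ∈ᵇ Y′
      Y′-intro {a} w y m = some-intro a (&&-intro w (&&-intro y m))

      Y′-elim : ∀ {y} → y ∈ᵇ Y′ → Side M W Y true y
      Y′-elim e with some-elim e
      ... | a , h with &&-elim {W a} h
      ...   | w , h′ with &&-elim {Y a} h′
      ...     | y , m = a , w , y , m

      meets : ∀ {y b} → y ∈ᵇ Y′ → b ∈ᵇ W → b ∉ᵇ Y → M b y ≡ true → y ∈ᵇ S
      meets {y} {b} y∈ w yb m = cut⊆S y (cut-intro {P = M} {W} {Y} λ where
        true  → Y′-elim y∈
        false → b , w , yb , m)

      outside : ∀ {i} → i ∈ᵇ W → i ∉ᵇ S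
      outside {i} w = not-true λ s → absurd (S⊆I i s) (neg-elim w)

      closed : ∀ a b → a ∉ᵇ S → b ∉ᵇ S → a ∈ᵇ Y′ → Adjacent G a b → b ∈ᵇ Y′
      closed a b a∉ b∉ a∈ ab with true-or-false (I b)
      ... | inj₂ b∉I with true-or-false (Y b)
      ...   | inj₁ yb = Y′-intro (neg-intro b∉I) yb (M-refl b)
      ...   | inj₂ yb = absurd (meets a∈ (neg-intro b∉I) yb (M-adj (adj-sym ab))) a∉
      closed a b a∉ b∉ a∈ ab | inj₁ b∈I with true-or-false (I a)
      ... | inj₁ a∈I = ⊥-elim (stable⇒¬adj st a∈I b∈I ab)
      ... | inj₂ a∉I with true-or-false (Y a)
      ...   | inj₁ ya = Y′-intro (neg-intro a∉I) ya (M-adj ab)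
      ...   | inj₂ ya = absurd (meets a∈ (neg-intro a∉I) ya (M-refl a)) a∉

      bi : Bipartition S Y′
      bi = let a , aw , ya = sp true ; b , bw , yb = sp false in record
        { left = a ; right = b ; left∉S = outside aw ; right∉S = outside bw
        ; left∈Y  = Y′-intro aw ya (M-refl a)
        ; right∉Y = not-true λ h → absurd (meets h bw yb (M-refl b)) (outside bw)
        ; closed  = closed }

    neighbour : Connected G → ∀ {u v} → u ≢ v → ∃[ w ] Adjacent G u w
    neighbour connected {u} {v} u≢v with connected u v ∈⊤ ∈⊤
    ... | ε = ⊥-elim (u≢v refl)
    ... | (_ , _ , e) ◅ _ = _ , e

    -- If the given vertex of a side lies in `I`, connectedness supplies a neighbour. It is outside
    -- `I` by independence, hence outside `S`, and so lies on the same side.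
    bipartition⇒hypergraph-cut : Connected G → ∀ {S Y} → S ⊆ᵇ I → Bipartition S Y →
                                 Splits W Y × cut M W Y ⊆ᵇ S
    bipartition⇒hypergraph-cut connected {S} {Y} S⊆I bi = splits , cut⊆S
      where
      open Bipartition bi

      left≢right : left ≢ right
      left≢right = ∈-∉-≢ {A = Y} left∈Y right∉Y

      outside : ∀ {i} → i ∉ᵇ I → i ∉ᵇ S
      outside {i} i∉ = not-true λ s → absurd (S⊆I i s) i∉

      splits : Splits W Y
      splits true with true-or-false (I left)
      ... | inj₂ h = left , neg-intro h , left∈Y
      ... | inj₁ h with neighbour connected left≢right
      ...   | w , e = w , neg-intro w∉I , closed left w left∉S (outside w∉I) left∈Y e
        where
        w∉I : w ∉ᵇ I
        w∉I = not-true λ k → stable⇒¬adj st h k e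
      splits false with true-or-false (I right)
      ... | inj₂ h = right , neg-intro h , right∉Y
      ... | inj₁ h with neighbour connected (left≢right ∘ sym)
      ...   | w , e = w , neg-intro w∉I ,
                      not-true λ k → absurd (closed w right (outside w∉I) right∉S k (adj-sym e)) right∉Y
        where
        w∉I : w ∉ᵇ I
        w∉I = not-true λ k → stable⇒¬adj st h k e

      cut⊆S : cut M W Y ⊆ᵇ S
      cut⊆S x h with true-or-false (S x) | cut-elim {P = M} {W} {Y} h true | cut-elim {P = M} {W} {Y} h false
      ... | inj₁ s | _ | _ = s
      ... | inj₂ x∉ | a , aw , ya , ma | b , bw , yb , mb = absurd b∈Y yb
        where
        x∈Y : x ∈ᵇ Y
        x∈Y = [ (λ { refl → ya }) , closed a x (outside (neg-elim aw)) x∉ ya ]′ (M-elim ma)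
        b∈Y : b ∈ᵇ Y
        b∈Y = [ (λ { refl → x∈Y }) , (λ e → closed x b x∉ (outside (neg-elim bw)) x∈Y (adj-sym e)) ]′ (M-elim mb)

  improves : Connected G → ∀ I → Stable I → Improves I
  improves connected I st {best₀} valid₀ = valid , shrinks , λ { {J} (cutset , _) J⊆I →
    -- The inequality is decidable, so the bipartition may be assumed although it exists only under
    -- double negation.
    decidable-stable (card (improve I M best₀) ≤? card J) λ worse →
      cutset⇒¬¬bipartition cutset λ split → worse (better (split , J⊆I)) }
    where
    Target : BSet n → Set
    Target J = (∃[ Y ] Bipartition J Y) × J ⊆ᵇ I
    W : BSet n
    W i = neg (I i)
    sound : ∀ Y → Splits W Y → ∀ S → S ⊆ᵇ I → S ⊆ᵇ cut M W Y → cut M W Y ⊆ᵇ S → Valid S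
    sound Y splits S S⊆I _ cut⊆S = inj₂ (hypergraph-cut⇒cutset st Y splits S S⊆I cut⊆S)
    complete : ∀ {J} → Target J → ∃[ Y ] (Splits W Y × cut M W Y ⊆ᵇ J)
    complete ((Y , bi) , J⊆I) = Y , bipartition⇒hypergraph-cut st connected J⊆I bi
    open Improvement I M Valid Target (inj₁ refl) sound proj₂ complete
    valid   = proj₁ (improve-correct valid₀)
    shrinks = proj₁ (proj₂ (improve-correct valid₀))
    better  = λ {J} → proj₂ (proj₂ (improve-correct valid₀)) {J}

  -- A vertex outside `S` would make `S` smaller than n; so no vertex is left, and the empty graph
  -- counts as connected.
  full-not-goal : ∀ {S} → n ≤ card S → ¬ Goal S
  full-not-goal {S} n≤ (cutset , _) = cutset λ u _ u∈ _ →
    ⊥-elim (<⇒≱ (card-mono-< {A = S} {B = full} (λ _ _ → refl) u (∈-∁⁻ u∈) refl)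
                (≤-trans (≤-reflexive (card-full n)) n≤))

  search : Connected G → ∃[ S₀ ] IndependentCutset G S₀ →
    ∃[ S ] ∃[ k ] (Run (step M) full (full , (λ _ → false) , fresh M full) S k × k ≤ nodes n ×
                   MinimumIndependentCutset G (tabulate S))
  search connected (S₀ , goal₀)
    with enumerate (improves connected) n n ≤-refl full (λ _ → false) full
           (record { stable = λ _ _ () ; apart = λ _ _ () }) (card≤n full) (inj₁ refl)
  ... | S , k , run , k≤ , valid , _ , better = S , k , run , k≤ , goal valid , minimum
    where
    minimum : ∀ S′ → IndependentCutset G S′ → ∣ tabulate S ∣ ≤ ∣ S′ ∣
    minimum S′ goal′ = subst₂ _≤_ (sym (∣tabulate∣ S)) (trans (sym (∣tabulate∣ (lookup S′))) (cong ∣_∣ S′≡))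
      (better goal″ st (fresh-covers {full} st (λ _ _ → inj₂ refl)))
      where
      S′≡ = tabulate∘lookup S′
      goal″ : Goal (lookup S′)
      goal″ = subst (IndependentCutset G) (sym S′≡) goal′
      st : Stable (lookup S′)
      st = independent⇒stable (proj₂ goal″)
    goal : Valid S → Goal S
    goal (inj₂ g)    = g
    -- If nothing had been found, minimality of `full` would give the cutset `S₀` at least n
    -- vertices.
    goal (inj₁ refl) = ⊥-elim (full-not-goal {lookup S₀}
      (≤-trans (≤-reflexive (trans (sym (card-full n)) (sym (∣tabulate∣ {n} full))))
        (≤-trans (minimum S₀ goal₀) (≤-reflexive (trans (cong ∣_∣ (sym (tabulate∘lookup S₀))) (∣tabulate∣ (lookup S₀))))))
      (subst (IndependentCutset G) (sym (tabulate∘lookup S₀)) goal₀))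

-- Encodings and the final program

encode-graph : ∀ {n} (G : Graph n) → encode mat (adj G) ≡ encodeGraph G
encode-graph G = cong encodeList (tabulate-cong λ u → cong encodeList (tabulate-∘ encodeBit (adj G u)))

encode-subset : ∀ {n} (S : BSet n) → encode set S ≡ encodeSubset (tabulate S)
encode-subset S = cong encodeList (tabulate-∘ encodeBit S)

open Branching {set} {bstate} {set} stepᵗ initᵗ

corollary3p6 : ∃[ P ] ∃[ T ] (T ∈O*[ 3 ^n/ 3 ] ×
    (∀ (n : ℕ) (G : Graph n) → Connected G → (∃[ S₀ ] IndependentCutset G S₀) →
    ∃[ S ] (MinimumIndependentCutset G S ×
    P on encodeGraph G outputs encodeSubset S within T n)))
corollary3p6 = program , time initCost stepCost , time-O* initCost stepCost , λ n G connected cutset →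
  let S , k , run , k≤ , min = search G connected cutset
      -- `refl` and `run` fit because the denotations of `initᵗ` and `stepᵗ` unfold to the initial
      -- state and to `step M`.
      t , eval↓ , t≤ = program-correct (adj G) refl run
  in tabulate S , min , t ,
     subst₂ (λ x y → Evaluation._⊢_⇓_[_] (Program.body program) (x ∷ []) (Program.main program) y t)
       (encode-graph G) (encode-subset S) eval↓ ,
     ≤-trans t≤ (+-monoʳ-≤ (eval initCost n) (*-monoˡ-≤ (eval stepCost n) k≤))
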